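{- Let $G=(V,E)$ be a finite connected block graph with boundary $\delta\Omega\subseteq V$. Let $D$ be the maximum degree of $G$ and let $B$ be the maximum size of the blocks of $G$. Suppose $D\ge 2$, $|\delta\Omega|\ge 2$, and $\delta\Omega$ is a subset of the leaf set of $G$. Then the first (non-trivial) Steklov eigenvalue $\lambda_2=\lambda_2(G,\delta\Omega)$ satisfies $$\lambda_2\le\frac{4(B-1)(D-1)}{|\delta\Omega|}.$$
   Context: All graphs are finite, simple and undirected. The leaf set is the set of vertices of degree one. A block of a graph is a maximal connected subgraph that has no cut vertex of its own (so a single edge $K_2$ may be a block); the size of a block is its number of vertices. A block graph is a connected graph all of whose blocks are complete graphs. The boundary $\delta\Omega$ of a graph $G=(V,E)$ is a chosen non-empty subset of $V$. For $f\in\mathbb{R}^V$ put $$R(f)=\frac{\sum_{(x,y)\in E}(f(x)-f(y))^2}{\sum_{x\in\delta\Omega}f(x)^2},$$ where each undirected edge is counted once, with the convention $R(f)=+\infty$ if $f$ vanishes identically on $\delta\Omega$. The Steklov eigenvalues $0=\lambda_1\le\lambda_2\le\cdots\le\lambda_{|\delta\Omega|}$ of $(G,\delta\Omega)$ are $$\lambda_k(G,\delta\Omega)=\min_{W\subset\mathbb{R}^V,\ \dim W=k}\ \max_{0\ne f\in W}R(f),\qquad 1\le k\le|\delta\Omega|,$$ with $W$ ranging over linear subspaces. -}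

module Defs where

open import Level using (Level; 0ℓ; _⊔_)
open import Data.Nat.Base as ℕ using (ℕ)
import Data.Nat.Properties as ℕ
open import Data.Rational.Base as ℚ using (ℚ; 0ℚ; 1ℚ; ½; ∣_∣)
import Data.Rational.Properties as ℚ
open import Data.Rational.Solver using (module +-*-Solver)
open import Data.Fin.Base using (Fin)
import Data.Fin.Properties as Fin
open import Data.Fin.Subset as Subset using (Subset; _∈_; _⊆_; Nonempty)
open import Data.Fin.Subset.Properties using (_∈?_; ∈⊤; x∈p∧x≢y⇒x∈p-y)
open import Data.List.Base using (List; foldr; filter; allFin; cartesianProduct)
import Data.Vec.Base as Vec
open import Data.Vec.Functional using (Vector)
open import Data.Product.Base using (Σ-syntax; ∃; ∃-syntax; ∃₂; _×_; _,_)
open import Function.Base using (flip)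
open import Relation.Binary.Core using (Rel; _⇒_)
open import Relation.Binary.Definitions using (Decidable; Symmetric)
open import Relation.Binary.PropositionalEquality.Core
  using (_≡_; _≢_; refl; sym; trans; cong; cong₂; subst)
open import Relation.Binary.Construct.Closure.ReflexiveTransitive using (Star)
import Relation.Binary.Construct.Add.Supremum.NonStrict as AddSupremum
open import Relation.Nullary.Construct.Add.Supremum using (_⁺; [_]; ⊤⁺)
open import Relation.Nullary.Decidable using (does; ¬?; _×-dec_)
open import Relation.Nullary.Negation.Core using (¬_)
open import Relation.Unary using (Pred)

private
  variable
    a ℓ ℓ′ : Level
    n : ℕ

-- "m = max P" and "m = min P" require that the extremum is attained.

IsGreatest : {A : Set a} → Rel A ℓ → Pred A ℓ′ → Pred A (a ⊔ ℓ ⊔ ℓ′)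
IsGreatest _≤_ P m = P m × (∀ {x} → P x → x ≤ m)

IsLeast : {A : Set a} → Rel A ℓ → Pred A ℓ′ → Pred A (a ⊔ ℓ ⊔ ℓ′)
IsLeast _≤_ = IsGreatest (flip _≤_)

------------------------------------------------------------------------
-- Real numbers: Cauchy sequences of rationals, compared by _≈ℝ_

-- "P holds for every ε > 0 and all sufficiently large n."
Eventually : (ℚ → ℕ → Set) → Set
Eventually P = ∀ ε → 0ℚ ℚ.< ε → ∃[ N ] (∀ n → N ℕ.≤ n → P ε n)

IsCauchy : (ℕ → ℚ) → Set
IsCauchy s = ∀ ε → 0ℚ ℚ.< ε →
  ∃[ N ] (∀ m n → N ℕ.≤ m → N ℕ.≤ n → ∣ s m ℚ.- s n ∣ ℚ.≤ ε)

record ℝ : Set where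
  constructor mkℝ
  field
    seq    : ℕ → ℚ
    cauchy : IsCauchy seq

open ℝ public

infix  4 _≈ℝ_ _≤ℝ_
infixl 6 _+ℝ_ _-ℝ_
infixl 7 _*ℝ_
infix  8 -ℝ_

_≈ℝ_ : Rel ℝ 0ℓ
x ≈ℝ y = Eventually λ ε n → ∣ seq x n ℚ.- seq y n ∣ ℚ.≤ ε

_≤ℝ_ : Rel ℝ 0ℓ
x ≤ℝ y = Eventually λ ε n → seq x n ℚ.≤ seq y n ℚ.+ ε

private
  open +-*-Solver

  -- abstract, or unfolding these proofs makes type checking very slow
  abstract
    diff-+ : ∀ p q r s → (p ℚ.+ q) ℚ.- (r ℚ.+ s) ≡ (p ℚ.- r) ℚ.+ (q ℚ.- s)
    diff-+ = solve 4 (λ x y z w → (x :+ y) :- (z :+ w) := (x :- z) :+ (y :- w)) refl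

    diff-neg : ∀ p q → ℚ.- (p ℚ.- q) ≡ (ℚ.- p) ℚ.- (ℚ.- q)
    diff-neg = solve 2 (λ x y → :- (x :- y) := (:- x) :- (:- y)) refl

    diff-add : ∀ p q → p ≡ (p ℚ.- q) ℚ.+ q
    diff-add = solve 2 (λ x y → x := (x :- y) :+ y) refl

    diff-* : ∀ p q r s → p ℚ.* q ℚ.- r ℚ.* s ≡ (q ℚ.- s) ℚ.* p ℚ.+ (p ℚ.- r) ℚ.* s
    diff-* = solve 4 (λ x y z w → x :* y :- z :* w := (y :- w) :* x :+ (x :- z) :* w) refl

    half-pos : ∀ ε → 0ℚ ℚ.< ε → 0ℚ ℚ.< ε ℚ.* ½
    half-pos ε 0<ε = ℚ.positive⁻¹ (ε ℚ.* ½) {{ℚ.pos*pos⇒pos ε {{ℚ.positive 0<ε}} ½}}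

    halves : ∀ ε → ε ℚ.* ½ ℚ.+ ε ℚ.* ½ ≡ ε
    halves ε = trans (sym (ℚ.*-distribˡ-+ ε ½ ½)) (ℚ.*-identityʳ ε)

    *-mono-≤-∣∣ : ∀ p q {r s} → ∣ p ∣ ℚ.≤ r → ∣ q ∣ ℚ.≤ s → ∣ p ℚ.* q ∣ ℚ.≤ r ℚ.* s
    *-mono-≤-∣∣ p q {r} {s} p≤r q≤s = begin
      ∣ p ℚ.* q ∣      ≡⟨ ℚ.∣p*q∣≡∣p∣*∣q∣ p q ⟩
      ∣ p ∣ ℚ.* ∣ q ∣  ≤⟨ ℚ.*-monoʳ-≤-nonNeg ∣ q ∣ {{ℚ.∣-∣-nonNeg q}} p≤r ⟩
      r ℚ.* ∣ q ∣      ≤⟨ ℚ.*-monoˡ-≤-nonNeg r {{ℚ.nonNegative (ℚ.≤-trans (ℚ.0≤∣p∣ p) p≤r)}} q≤s ⟩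
      r ℚ.* s          ∎
      where open ℚ.≤-Reasoning

    const-cauchy : ∀ q → IsCauchy (λ _ → q)
    const-cauchy q ε 0<ε = 0 , λ _ _ _ _ →
      subst (ℚ._≤ ε) (cong ∣_∣ (sym (ℚ.+-inverseʳ q))) (ℚ.<⇒≤ 0<ε)

    +-cauchy : ∀ {s t} → IsCauchy s → IsCauchy t → IsCauchy (λ n → s n ℚ.+ t n)
    +-cauchy {s} {t} cs ct ε 0<ε
      with M , hs ← cs (ε ℚ.* ½) (half-pos ε 0<ε)
         | N , ht ← ct (ε ℚ.* ½) (half-pos ε 0<ε)
      = M ℕ.⊔ N , λ m n m≥ n≥ → begin
        ∣ (s m ℚ.+ t m) ℚ.- (s n ℚ.+ t n) ∣
          ≡⟨ cong ∣_∣ (diff-+ (s m) (t m) (s n) (t n)) ⟩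
        ∣ (s m ℚ.- s n) ℚ.+ (t m ℚ.- t n) ∣
          ≤⟨ ℚ.∣p+q∣≤∣p∣+∣q∣ (s m ℚ.- s n) (t m ℚ.- t n) ⟩
        ∣ s m ℚ.- s n ∣ ℚ.+ ∣ t m ℚ.- t n ∣
          ≤⟨ ℚ.+-mono-≤ (hs m n (ℕ.m⊔n≤o⇒m≤o M N m≥) (ℕ.m⊔n≤o⇒m≤o M N n≥))
                        (ht m n (ℕ.m⊔n≤o⇒n≤o M N m≥) (ℕ.m⊔n≤o⇒n≤o M N n≥)) ⟩
        ε ℚ.* ½ ℚ.+ ε ℚ.* ½
          ≡⟨ halves ε ⟩
        ε ∎
      where open ℚ.≤-Reasoning

    neg-cauchy : ∀ {s} → IsCauchy s → IsCauchy (λ n → ℚ.- s n)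
    neg-cauchy {s} cs ε 0<ε with N , h ← cs ε 0<ε = N , λ m n m≥ n≥ →
      subst (ℚ._≤ ε)
        (trans (sym (ℚ.∣-p∣≡∣p∣ (s m ℚ.- s n)))
               (cong ∣_∣ (diff-neg (s m) (s n))))
        (h m n m≥ n≥)

    0<1 : 0ℚ ℚ.< 1ℚ
    0<1 = ℚ.positive⁻¹ 1ℚ

    eventually-bounded : ∀ {s} → IsCauchy s →
      ∃₂ λ N K → 0ℚ ℚ.< K × (∀ n → N ℕ.≤ n → ∣ s n ∣ ℚ.≤ K)
    eventually-bounded {s} cs with N , h ← cs 1ℚ 0<1 =
      N , 1ℚ ℚ.+ ∣ s N ∣ , ℚ.+-mono-<-≤ 0<1 (ℚ.0≤∣p∣ (s N)) , λ n n≥ → begin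
        ∣ s n ∣
          ≡⟨ cong ∣_∣ (diff-add (s n) (s N)) ⟩
        ∣ (s n ℚ.- s N) ℚ.+ s N ∣
          ≤⟨ ℚ.∣p+q∣≤∣p∣+∣q∣ (s n ℚ.- s N) (s N) ⟩
        ∣ s n ℚ.- s N ∣ ℚ.+ ∣ s N ∣
          ≤⟨ ℚ.+-monoˡ-≤ ∣ s N ∣ (h n N n≥ ℕ.≤-refl) ⟩
        1ℚ ℚ.+ ∣ s N ∣ ∎
      where open ℚ.≤-Reasoning

    quotient : ∀ ε C → 0ℚ ℚ.< ε → 0ℚ ℚ.< C → ∃[ δ ] 0ℚ ℚ.< δ × δ ℚ.* C ≡ ε
    quotient ε C 0<ε 0<C =
      ε ℚ.* C⁻¹ ,
      ℚ.positive⁻¹ (ε ℚ.* C⁻¹)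
        {{ℚ.pos*pos⇒pos ε {{ℚ.positive 0<ε}} C⁻¹ {{ℚ.1/pos⇒pos C {{ℚ.positive 0<C}}}}}} ,
      trans (ℚ.*-assoc ε C⁻¹ C)
        (trans (cong (ε ℚ.*_) (ℚ.*-inverseˡ C {{C≢0}})) (ℚ.*-identityʳ ε))
      where
      C≢0 : ℚ.NonZero C
      C≢0 = ℚ.pos⇒nonZero C {{ℚ.positive 0<C}}
      C⁻¹ : ℚ
      C⁻¹ = ℚ.1/_ C {{C≢0}}

    *-diff-bound : ∀ p q r s {δ C ε} → δ ℚ.* C ≡ ε ℚ.* ½ →
      ∣ p ℚ.- r ∣ ℚ.≤ δ → ∣ q ℚ.- s ∣ ℚ.≤ δ → ∣ p ∣ ℚ.≤ C → ∣ s ∣ ℚ.≤ C →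
      ∣ p ℚ.* q ℚ.- r ℚ.* s ∣ ℚ.≤ ε
    *-diff-bound p q r s {δ} {C} {ε} δC p-r q-s p≤C s≤C = begin
      ∣ p ℚ.* q ℚ.- r ℚ.* s ∣
        ≡⟨ cong ∣_∣ (diff-* p q r s) ⟩
      ∣ (q ℚ.- s) ℚ.* p ℚ.+ (p ℚ.- r) ℚ.* s ∣
        ≤⟨ ℚ.∣p+q∣≤∣p∣+∣q∣ ((q ℚ.- s) ℚ.* p) ((p ℚ.- r) ℚ.* s) ⟩
      ∣ (q ℚ.- s) ℚ.* p ∣ ℚ.+ ∣ (p ℚ.- r) ℚ.* s ∣
        ≤⟨ ℚ.+-mono-≤ (*-mono-≤-∣∣ (q ℚ.- s) p q-s p≤C) (*-mono-≤-∣∣ (p ℚ.- r) s p-r s≤C) ⟩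
      δ ℚ.* C ℚ.+ δ ℚ.* C
        ≡⟨ cong₂ ℚ._+_ δC δC ⟩
      ε ℚ.* ½ ℚ.+ ε ℚ.* ½
        ≡⟨ halves ε ⟩
      ε ∎
      where open ℚ.≤-Reasoning

    *-cauchy : ∀ {s t} → IsCauchy s → IsCauchy t → IsCauchy (λ n → s n ℚ.* t n)
    *-cauchy {s} {t} cs ct ε 0<ε = fromBounds (eventually-bounded cs) (eventually-bounded ct)
      where
      Goal : Set
      Goal = ∃[ N ] (∀ m n → N ℕ.≤ m → N ℕ.≤ n → ∣ s m ℚ.* t m ℚ.- s n ℚ.* t n ∣ ℚ.≤ ε)

      Bound : (ℕ → ℚ) → Set
      Bound u = ∃₂ λ N K → 0ℚ ℚ.< K × (∀ n → N ℕ.≤ n → ∣ u n ∣ ℚ.≤ K)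

      Close : ℚ → (ℕ → ℚ) → Set
      Close δ u = ∃[ N ] (∀ m n → N ℕ.≤ m → N ℕ.≤ n → ∣ u m ℚ.- u n ∣ ℚ.≤ δ)

      combine : ∀ {δ C} N₁ N₂ → δ ℚ.* C ≡ ε ℚ.* ½ →
        (∀ n → N₁ ℕ.≤ n → ∣ s n ∣ ℚ.≤ C) → (∀ n → N₂ ℕ.≤ n → ∣ t n ∣ ℚ.≤ C) →
        Close δ s → Close δ t → Goal
      combine N₁ N₂ δC bs bt (N₃ , hs) (N₄ , ht) = (N₁ ℕ.⊔ N₂) ℕ.⊔ (N₃ ℕ.⊔ N₄) , λ m n m≥ n≥ →
        *-diff-bound (s m) (t m) (s n) (t n) δC
          (hs m n (≥N₃ m≥) (≥N₃ n≥)) (ht m n (≥N₄ m≥) (≥N₄ n≥)) (bs m (≥N₁ m≥)) (bt n (≥N₂ n≥))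
        where
        ≥N₁ : ∀ {k} → (N₁ ℕ.⊔ N₂) ℕ.⊔ (N₃ ℕ.⊔ N₄) ℕ.≤ k → N₁ ℕ.≤ k
        ≥N₁ k≥ = ℕ.m⊔n≤o⇒m≤o N₁ N₂ (ℕ.m⊔n≤o⇒m≤o (N₁ ℕ.⊔ N₂) (N₃ ℕ.⊔ N₄) k≥)
        ≥N₂ : ∀ {k} → (N₁ ℕ.⊔ N₂) ℕ.⊔ (N₃ ℕ.⊔ N₄) ℕ.≤ k → N₂ ℕ.≤ k
        ≥N₂ k≥ = ℕ.m⊔n≤o⇒n≤o N₁ N₂ (ℕ.m⊔n≤o⇒m≤o (N₁ ℕ.⊔ N₂) (N₃ ℕ.⊔ N₄) k≥)
        ≥N₃ : ∀ {k} → (N₁ ℕ.⊔ N₂) ℕ.⊔ (N₃ ℕ.⊔ N₄) ℕ.≤ k → N₃ ℕ.≤ k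
        ≥N₃ k≥ = ℕ.m⊔n≤o⇒m≤o N₃ N₄ (ℕ.m⊔n≤o⇒n≤o (N₁ ℕ.⊔ N₂) (N₃ ℕ.⊔ N₄) k≥)
        ≥N₄ : ∀ {k} → (N₁ ℕ.⊔ N₂) ℕ.⊔ (N₃ ℕ.⊔ N₄) ℕ.≤ k → N₄ ℕ.≤ k
        ≥N₄ k≥ = ℕ.m⊔n≤o⇒n≤o N₃ N₄ (ℕ.m⊔n≤o⇒n≤o (N₁ ℕ.⊔ N₂) (N₃ ℕ.⊔ N₄) k≥)

      fromBounds : Bound s → Bound t → Goal
      fromBounds (N₁ , K , 0<K , bs) (N₂ , L , 0<L , bt) =
        fromQuotient (quotient (ε ℚ.* ½) (K ℚ.+ L) (half-pos ε 0<ε) (ℚ.+-mono-< 0<K 0<L))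
        where
        K≤K+L : K ℚ.≤ K ℚ.+ L
        K≤K+L = subst (ℚ._≤ K ℚ.+ L) (ℚ.+-identityʳ K) (ℚ.+-monoʳ-≤ K (ℚ.<⇒≤ 0<L))
        L≤K+L : L ℚ.≤ K ℚ.+ L
        L≤K+L = subst (ℚ._≤ K ℚ.+ L) (ℚ.+-identityˡ L) (ℚ.+-monoˡ-≤ L (ℚ.<⇒≤ 0<K))
        fromQuotient : (∃[ δ ] 0ℚ ℚ.< δ × δ ℚ.* (K ℚ.+ L) ≡ ε ℚ.* ½) → Goal
        fromQuotient (δ , 0<δ , δC) = combine N₁ N₂ δC
          (λ n n≥ → ℚ.≤-trans (bs n n≥) K≤K+L) (λ n n≥ → ℚ.≤-trans (bt n n≥) L≤K+L)
          (cs δ 0<δ) (ct δ 0<δ)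

fromℚ : ℚ → ℝ
fromℚ q = mkℝ (λ _ → q) (const-cauchy q)

0ℝ : ℝ
0ℝ = fromℚ 0ℚ

_+ℝ_ : ℝ → ℝ → ℝ
x +ℝ y = mkℝ (λ n → seq x n ℚ.+ seq y n) (+-cauchy {seq x} {seq y} (cauchy x) (cauchy y))

-ℝ_ : ℝ → ℝ
-ℝ x = mkℝ (λ n → ℚ.- seq x n) (neg-cauchy {seq x} (cauchy x))

_-ℝ_ : ℝ → ℝ → ℝ
x -ℝ y = x +ℝ (-ℝ y)

_*ℝ_ : ℝ → ℝ → ℝ
x *ℝ y = mkℝ (λ n → seq x n ℚ.* seq y n) (*-cauchy {seq x} {seq y} (cauchy x) (cauchy y))

_² : ℝ → ℝ
x ² = x *ℝ x

∑ : {A : Set a} → List A → (A → ℝ) → ℝ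
∑ xs f = foldr (λ x acc → f x +ℝ acc) 0ℝ xs

infix 4 _≤∞_

-- ℝ ⁺ is ℝ ∪ {+∞}, with ⊤⁺ = +∞.
_≤∞_ : Rel (ℝ ⁺) 0ℓ
_≤∞_ = AddSupremum._≤⁺_ _≤ℝ_

------------------------------------------------------------------------
-- Linear subspaces of ℝⁿ

infix 4 _≈ᵥ_

_≈ᵥ_ : Rel (Vector ℝ n) 0ℓ
f ≈ᵥ g = ∀ x → f x ≈ℝ g x

0ᵥ : Vector ℝ n
0ᵥ _ = 0ℝ

record IsSubspace {n} (W : Pred (Vector ℝ n) 0ℓ) : Set where
  field
    resp-≈ : ∀ {f g} → f ≈ᵥ g → W f → W g
    0∈     : W 0ᵥ
    +-clos : ∀ {f g} → W f → W g → W (λ x → f x +ℝ g x)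
    ·-clos : ∀ c {f} → W f → W (λ x → c *ℝ f x)

linearCombination : ∀ {k} → Vector ℝ k → Vector (Vector ℝ n) k → Vector ℝ n
linearCombination {k = k} c b x = ∑ (allFin k) λ i → c i *ℝ b i x

record IsBasis {n k} (W : Pred (Vector ℝ n) 0ℓ) (b : Vector (Vector ℝ n) k) : Set where
  field
    inside      : ∀ i → W (b i)
    independent : ∀ c → linearCombination c b ≈ᵥ 0ᵥ → c ≈ᵥ 0ᵥ
    spanning    : ∀ {f} → W f → ∃[ c ] f ≈ᵥ linearCombination c b

HasDimension : Pred (Vector ℝ n) 0ℓ → ℕ → Set
HasDimension {n} W k = Σ[ b ∈ Vector (Vector ℝ n) k ] IsBasis W b

------------------------------------------------------------------------
-- Finite simple graphs on the vertex set Fin n, and their subgraphs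

record Graph (n : ℕ) : Set₁ where
  infix 4 _~_ _~?_
  field
    _~_      : Rel (Fin n) 0ℓ
    _~?_     : Decidable _~_
    ~-sym    : Symmetric _~_
    ~-irrefl : ∀ {x} → ¬ (x ~ x)

  -- One ordered pair (x , y), x < y, per undirected edge.
  edges : List (Fin n × Fin n)
  edges = filter (λ (x , y) → (x Fin.<? y) ×-dec (x ~? y))
                 (cartesianProduct (allFin n) (allFin n))

  neighbours : Fin n → Subset n
  neighbours x = Vec.tabulate λ y → does (x ~? y)

  degree : Fin n → ℕ
  degree x = Subset.∣ neighbours x ∣

  leafSet : Subset n
  leafSet = Vec.tabulate λ x → does (degree x ℕ.≟ 1)

-- A subgraph need not be induced: it has its own edge relation E.
record Subgraph (G : Graph n) : Set₁ where
  open Graph G using (_~_)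
  field
    V     : Subset n
    E     : Rel (Fin n) 0ℓ
    E?    : Decidable E
    E-sym : Symmetric E
    E⇒~   : E ⇒ _~_
    E⇒∈   : ∀ {x y} → E x y → x ∈ V

module _ {G : Graph n} where
  open Graph G
  open Subgraph

  infix  4 _⊑_
  infixl 6 _─_

  _⊑_ : Rel (Subgraph G) 0ℓ
  H ⊑ K = (V H ⊆ V K) × (E H ⇒ E K)

  _─_ : Subgraph G → Fin n → Subgraph G
  H ─ v = record
    { V     = V H Subset.- v
    ; E     = λ x y → E H x y × x ≢ v × y ≢ v
    ; E?    = λ x y → E? H x y ×-dec ¬? (x Fin.≟ v) ×-dec ¬? (y Fin.≟ v)
    ; E-sym = λ (e , x≢v , y≢v) → E-sym H e , y≢v , x≢v
    ; E⇒~   = λ (e , _) → E⇒~ H e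
    ; E⇒∈   = λ (e , x≢v , _) → x∈p∧x≢y⇒x∈p-y (E⇒∈ H e) x≢v
    }

  Joined : Subgraph G → Rel (Fin n) 0ℓ
  Joined H = Star (E H)

  IsConnected : Subgraph G → Set
  IsConnected H = Nonempty (V H) × (∀ {x y} → x ∈ V H → y ∈ V H → Joined H x y)

  -- Deleting v separates two other vertices that were joined in H, i.e.
  -- increases the number of components; so K₁ has no cut vertex.
  IsCutVertex : Subgraph G → Fin n → Set
  IsCutVertex H v = v ∈ V H × ∃₂ λ x y →
    x ∈ V (H ─ v) × y ∈ V (H ─ v) × Joined H x y × ¬ Joined (H ─ v) x y

  IsComplete : Subgraph G → Set
  IsComplete H = ∀ {x y} → x ∈ V H → y ∈ V H → x ≢ y → E H x y

  IsConnectedWithoutCutVertex : Subgraph G → Set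
  IsConnectedWithoutCutVertex H = IsConnected H × (∀ v → ¬ IsCutVertex H v)

  IsBlock : Subgraph G → Set₁
  IsBlock H = IsConnectedWithoutCutVertex H ×
    (∀ K → IsConnectedWithoutCutVertex K → H ⊑ K → K ⊑ H)

  size : Subgraph G → ℕ
  size H = Subset.∣ V H ∣

module _ (G : Graph n) where
  open Graph G

  whole : Subgraph G
  whole = record
    { V     = Subset.⊤
    ; E     = _~_
    ; E?    = _~?_
    ; E-sym = ~-sym
    ; E⇒~   = λ e → e
    ; E⇒∈   = λ _ → ∈⊤
    }

  IsBlockGraph : Set₁
  IsBlockGraph = IsConnected whole × (∀ (H : Subgraph G) → IsBlock H → IsComplete H)

  IsMaxDegree : ℕ → Set
  IsMaxDegree = IsGreatest ℕ._≤_ λ d → ∃[ x ] degree x ≡ d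

  IsMaxBlockSize : ℕ → Set₁
  IsMaxBlockSize = IsGreatest ℕ._≤_ λ s → Σ[ H ∈ Subgraph G ] IsBlock H × size H ≡ s

------------------------------------------------------------------------
-- Steklov eigenvalues

  module _ (δΩ : Subset n) where

    energy : Vector ℝ n → ℝ
    energy f = ∑ edges λ (x , y) → (f x -ℝ f y) ²

    boundaryNorm² : Vector ℝ n → ℝ
    boundaryNorm² f = ∑ (filter (_∈? δΩ) (allFin n)) λ x → f x ²

    VanishesOnBoundary : Pred (Vector ℝ n) 0ℓ
    VanishesOnBoundary f = ∀ x → x ∈ δΩ → f x ≈ℝ 0ℝ

    -- "R(f) = ρ".  A relation, since whether f vanishes on δΩ, and hence
    -- whether R(f) is a quotient or +∞, is not decidable.
    data IsRayleighQuotient (f : Vector ℝ n) : ℝ ⁺ → Set where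
      finite   : ∀ {r} → ¬ VanishesOnBoundary f →
                 r *ℝ boundaryNorm² f ≈ℝ energy f → IsRayleighQuotient f [ r ]
      infinite : VanishesOnBoundary f → IsRayleighQuotient f ⊤⁺

    IsMaxRayleighQuotient : Pred (Vector ℝ n) 0ℓ → ℝ ⁺ → Set
    IsMaxRayleighQuotient W = IsGreatest _≤∞_ λ ρ →
      ∃[ f ] W f × ¬ (f ≈ᵥ 0ᵥ) × IsRayleighQuotient f ρ

    -- "λₖ(G, δΩ) = μ".
    IsSteklovEigenvalue : ℕ → ℝ ⁺ → Set₁
    IsSteklovEigenvalue k = IsLeast _≤∞_ λ μ →
      Σ[ W ∈ Pred (Vector ℝ n) 0ℓ ]
        IsSubspace W × HasDimension W k × IsMaxRayleighQuotient W μ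

{-# OPTIONS --safe #-}

-- Root the block graph at a boundary leaf r and let T t consist of t and the vertices that t
-- separates from r.  Two neighbours of t that are joined in G - t are adjacent, as they lie with t
-- on a cycle and hence in one block.  So the edges leaving T t join t to fewer than B vertices, and
-- T t minus t is covered by the sets T s of at most D - 1 neighbours s of t.  Descending from the
-- neighbour of r to a minimal T = T t with D |T ∩ δΩ| ≥ |δΩ|, one also gets D |δΩ ─ T| ≥ |δΩ|.
-- The function equal to |δΩ ─ T| on T and to - |T ∩ δΩ| elsewhere has zero boundary sum, so its
-- Rayleigh quotient is the maximum over the plane it spans with 1 and bounds λ₂.  The inequality
-- being proved is stable under double negation, so joinedness may be assumed decidable.

module Submission where

open import Defs
open import Data.Nat.Base using (ℕ; _≤_; >-nonZero)
open import Data.Nat.Properties using (<⇒≤)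
open import Data.Integer.Base using (+_; _-_; _*_)
open import Data.Rational.Base using (_/_)
open import Data.Fin.Subset using (Subset; _⊆_; ∣_∣)
open import Relation.Nullary.Construct.Add.Supremum using (_⁺; [_])
open import Level using (0ℓ)
import Data.Nat.Base as ℕ
import Data.Nat.Properties as ℕ
import Data.Nat.Tactic.RingSolver as ℕ-Solver
import Data.Integer.Base as ℤ
import Data.Integer.Properties as ℤ
open import Data.Rational.Base as ℚ using (ℚ; 0ℚ; 1ℚ; ½; fromℚᵘ)
import Data.Rational.Properties as ℚ
open import Data.Rational.Solver using (module +-*-Solver)
import Data.Rational.Unnormalised.Base as ℚᵘ
import Data.Rational.Unnormalised.Properties as ℚᵘ
open import Data.Bool.Base using (Bool; true; false; if_then_else_)
open import Data.Empty using (⊥-elim)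
open import Data.Fin.Base as Fin using (Fin; zero; suc)
open import Data.Fin.Properties using (_≟_; _<?_; <-asym; any?; sequence)
open import Data.Fin.Subset as Subset
  using (_∈_; _∉_; _⊃_; _⊂_; _∩_; _∪_; ⁅_⁆; Nonempty; inside; outside)
open import Data.Fin.Subset.Properties
open import Data.Fin.Subset.Induction using (⊃-wellFounded; ⊂-wellFounded; Acc; acc)
open import Data.List.Base
  using (List; []; _∷_; _++_; map; foldr; filter; allFin; tabulate; cartesianProduct)
open import Data.Product.Base using (Σ-syntax; ∃-syntax; ∃₂; _×_; _,_; proj₁; proj₂)
open import Data.Sum.Base using (_⊎_; inj₁; inj₂; [_,_]′)
open import Data.Unit.Base using (⊤; tt)
open import Data.Vec.Base as Vec using ([]; _∷_; here; there)
open import Data.Vec.Functional using (Vector)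
open import Effect.Monad using (RawMonad)
open import Function.Base using (_∘_; id)
open import Relation.Binary.Core using (Rel)
open import Relation.Binary.Construct.Add.Supremum.NonStrict _≤ℝ_ using ([_]; [≤]-injective)
open import Relation.Binary.Construct.Closure.ReflexiveTransitive as Star using (Star; _◅_; _◅◅_)
open import Relation.Binary.Definitions using (Symmetric; DecidableEquality)
open import Relation.Binary.PropositionalEquality
  using (_≡_; _≢_; refl; sym; trans; cong; cong₂; subst; subst₂; module ≡-Reasoning)
open import Relation.Nullary.Construct.Add.Supremum using (⊤⁺)
open import Relation.Nullary.Decidable
  using (Dec; yes; no; does; _⊎-dec_; _×-dec_; ¬?; ¬¬-excluded-middle)
open import Relation.Nullary.Negation using (¬_; contradiction; ¬¬-Monad; ¬¬-map)
open import Relation.Unary using (Pred; Decidable)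

-- Walks

-- Write w = |T ∩ δΩ|, b = |δΩ ─ T| and L = w + b. The test function jumps by exactly L along each
-- edge leaving T and has squared boundary norm w b L, so its quotient is at most (B - 1) L / (w b),
-- and it suffices that L² ≤ 4 (D - 1) w b. Cancelling w in L ≤ D w leaves b ≤ (D - 1) w, and
-- symmetrically with w and b exchanged; this is why the bound has D - 1 and not D. The 4 comes from
-- estimating L by twice the larger of w and b. A block is maximal among all subgraphs, a property
-- over which no case distinction is available, so a block containing a given vertex set is produced
-- only up to double negation. This is enough because blocks are only used to derive adjacency of
-- two vertices and inequalities between natural numbers, both of which are decidable.

Within : {A : Set} → Pred A 0ℓ → Rel A 0ℓ → Rel A 0ℓ
Within P R x y = R x y × P x × P y

Within-sym : {A : Set} (P : Pred A 0ℓ) (R : Rel A 0ℓ) → Symmetric R → Symmetric (Within P R)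
Within-sym _ _ sym-R (e , Px , Py) = sym-R e , Py , Px

within-target : {A : Set} (P : Pred A 0ℓ) {R : Rel A 0ℓ} {x y : A} →
  Star (Within P R) x y → P x → P y
within-target P Star.ε             Px = Px
within-target P ((_ , _ , Pz) ◅ p) _  = within-target P p Pz

module _ {A : Set} {R : Rel A 0ℓ} where

  infix 4 _∈ʷ_

  _∈ʷ_ : A → ∀ {x y} → Star R x y → Set
  _∈ʷ_ v {x} Star.ε  = v ≡ x
  _∈ʷ_ v {x} (_ ◅ p) = v ≡ x ⊎ v ∈ʷ p

  IsSimple : ∀ {x y} → Star R x y → Set
  IsSimple Star.ε      = ⊤
  IsSimple {x} (_ ◅ p) = ¬ x ∈ʷ p × IsSimple p

  source∈ : ∀ {x y} (p : Star R x y) → x ∈ʷ p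
  source∈ Star.ε  = refl
  source∈ (_ ◅ _) = inj₁ refl

  target∈ : ∀ {x y} (p : Star R x y) → y ∈ʷ p
  target∈ Star.ε  = refl
  target∈ (_ ◅ p) = inj₂ (target∈ p)

  within : ∀ {P : Pred A 0ℓ} {x y} (p : Star R x y) →
    (∀ {v} → v ∈ʷ p → P v) → Star (Within P R) x y
  within Star.ε  _ = Star.ε
  within (e ◅ p) h = (e , h (inj₁ refl) , h (inj₂ (source∈ p))) ◅ within p (h ∘ inj₂)

  suffix : ∀ {x y u} (p : Star R x y) → u ∈ʷ p →
    Σ[ q ∈ Star R u y ] (∀ {v} → v ∈ʷ q → v ∈ʷ p) × (IsSimple p → IsSimple q)
  suffix Star.ε  refl        = Star.ε , id , id
  suffix (e ◅ p) (inj₁ refl) = e ◅ p , id , id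
  suffix (e ◅ p) (inj₂ u∈p) with q , q⊆p , simple ← suffix p u∈p =
    q , inj₂ ∘ q⊆p , simple ∘ proj₂

  prefix : ∀ {x y u} (p : Star R x y) → u ∈ʷ p → Star R x u
  prefix Star.ε  refl        = Star.ε
  prefix (e ◅ p) (inj₁ refl) = Star.ε
  prefix (e ◅ p) (inj₂ u∈p)  = e ◅ prefix p u∈p

  module _ (_≟ᴬ_ : DecidableEquality A) where

    _∈ʷ?_ : ∀ v {x y} (p : Star R x y) → Dec (v ∈ʷ p)
    _∈ʷ?_ v {x} Star.ε  = v ≟ᴬ x
    _∈ʷ?_ v {x} (_ ◅ p) = (v ≟ᴬ x) ⊎-dec (_∈ʷ?_ v p)

    simplify : ∀ {x y} → Star R x y → Σ[ p ∈ Star R x y ] IsSimple p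
    simplify Star.ε = Star.ε , tt
    simplify {x} (e ◅ p) with simplify p
    ... | q , sq with _∈ʷ?_ x q
    ...   | yes x∈q = let r , _ , simple = suffix q x∈q in r , simple sq
    ...   | no  x∉q = e ◅ q , x∉q , sq

    -- A simple path meets `w` at most once, so `w` blocks at most one of the two directions in
    -- which `u` can leave along the path. This is what keeps a cycle connected after the loss of a
    -- vertex.
    simple-ends : Symmetric R → ∀ {P : Pred A 0ℓ} {w u x y} (p : Star R x y) → IsSimple p →
      (∀ {v} → v ∈ʷ p → v ≢ w → P v) → u ∈ʷ p → u ≢ w →
      Star (Within P R) u x ⊎ Star (Within P R) u y
    simple-ends sym-R Star.ε  _ h refl        _ = inj₁ Star.ε
    simple-ends sym-R (e ◅ p) _ h (inj₁ refl) _ = inj₁ Star.ε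
    simple-ends sym-R {P} {w} {x = x} (e ◅ p) (x∉p , sp) h (inj₂ u∈p) u≢w
      with simple-ends sym-R p sp (h ∘ inj₂) u∈p u≢w | x ≟ᴬ w
    ... | inj₂ u→y | _        = inj₂ u→y
    ... | inj₁ u→z | no  x≢w  =
      inj₁ (u→z ◅◅ (sym-R e , within-target P u→z (h (inj₂ u∈p) u≢w) , h (inj₁ refl) x≢w) ◅ Star.ε)
    -- Now `w` is the source itself. Simplicity keeps the rest of the path off it, so the far end is
    -- reached instead.
    ... | inj₁ _   | yes refl with q , q⊆p , _ ← suffix p u∈p =
      inj₂ (within q (λ v∈q → h (inj₂ (q⊆p v∈q)) (λ { refl → x∉p (q⊆p v∈q) })))

-- Subsets of Fin n

comprehension : ∀ {n} {P : Pred (Fin n) 0ℓ} → Decidable P → Subset n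
comprehension P? = Vec.tabulate (does ∘ P?)

∈-comprehension⁺ : ∀ {n} {P : Pred (Fin n) 0ℓ} (P? : Decidable P) {x} →
  P x → x ∈ comprehension P?
∈-comprehension⁺ {ℕ.suc n} P? {zero} Px with P? zero
... | yes _   = here
... | no  ¬P0 = contradiction Px ¬P0
∈-comprehension⁺ {ℕ.suc n} P? {suc x} Px = there (∈-comprehension⁺ (P? ∘ suc) Px)

∈-comprehension⁻ : ∀ {n} {P : Pred (Fin n) 0ℓ} (P? : Decidable P) {x} →
  x ∈ comprehension P? → P x
∈-comprehension⁻ {ℕ.suc n} P? {zero} x∈ with P? zero | x∈
... | yes P0 | _ = P0
∈-comprehension⁻ {ℕ.suc n} P? {suc x} (there x∈) = ∈-comprehension⁻ (P? ∘ suc) x∈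

x∈p─q⇒x∉q : ∀ {n} {x : Fin n} (p q : Subset n) → x ∈ p Subset.─ q → x ∉ q
x∈p─q⇒x∉q (inside ∷ p) (outside ∷ q) here       ()
x∈p─q⇒x∉q (_ ∷ p)      (_ ∷ q)      (there x∈) (there x∈q) = x∈p─q⇒x∉q p q x∈ x∈q

x∈p-y⇒x≢y : ∀ {n} {x y : Fin n} (p : Subset n) → x ∈ p Subset.- y → x ≢ y
x∈p-y⇒x≢y {x = x} p x∈ refl = x∈p─q⇒x∉q p ⁅ x ⁆ x∈ (x∈⁅x⁆ x)

∣p∪q∣≤∣p∣+∣q∣ : ∀ {n} (p q : Subset n) → ∣ p ∪ q ∣ ≤ ∣ p ∣ ℕ.+ ∣ q ∣
∣p∪q∣≤∣p∣+∣q∣ []            []            = ℕ.z≤n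
∣p∪q∣≤∣p∣+∣q∣ (inside  ∷ p) (s ∷ q)       =
  ℕ.s≤s (ℕ.≤-trans (∣p∪q∣≤∣p∣+∣q∣ p q) (ℕ.+-monoʳ-≤ ∣ p ∣ (∣p∣≤∣x∷p∣ s q)))
∣p∪q∣≤∣p∣+∣q∣ (outside ∷ p) (inside  ∷ q) =
  ℕ.≤-trans (ℕ.s≤s (∣p∪q∣≤∣p∣+∣q∣ p q)) (ℕ.≤-reflexive (sym (ℕ.+-suc ∣ p ∣ ∣ q ∣)))
∣p∪q∣≤∣p∣+∣q∣ (outside ∷ p) (outside ∷ q) = ∣p∪q∣≤∣p∣+∣q∣ p q

∣p∩q∣+∣q─p∣≡∣q∣ : ∀ {n} (p q : Subset n) → ∣ p ∩ q ∣ ℕ.+ ∣ q Subset.─ p ∣ ≡ ∣ q ∣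
∣p∩q∣+∣q─p∣≡∣q∣ []            []            = refl
∣p∩q∣+∣q─p∣≡∣q∣ (inside  ∷ p) (inside  ∷ q) = cong ℕ.suc (∣p∩q∣+∣q─p∣≡∣q∣ p q)
∣p∩q∣+∣q─p∣≡∣q∣ (inside  ∷ p) (outside ∷ q) = ∣p∩q∣+∣q─p∣≡∣q∣ p q
∣p∩q∣+∣q─p∣≡∣q∣ (outside ∷ p) (inside  ∷ q) =
  trans (ℕ.+-suc ∣ p ∩ q ∣ ∣ q Subset.─ p ∣) (cong ℕ.suc (∣p∩q∣+∣q─p∣≡∣q∣ p q))
∣p∩q∣+∣q─p∣≡∣q∣ (outside ∷ p) (outside ∷ q) = ∣p∩q∣+∣q─p∣≡∣q∣ p q

0<∣p∣⇒Nonempty : ∀ {n} (p : Subset n) → 0 ℕ.< ∣ p ∣ → Nonempty p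
0<∣p∣⇒Nonempty {n} p 0<p with nonempty? p
... | yes nonempty = nonempty
... | no  empty    =
  contradiction 0<p (ℕ.≤⇒≯ (ℕ.≤-reflexive (trans (cong ∣_∣ (Empty-unique empty)) (∣⊥∣≡0 n))))

-- The factor `D` is carried along so that an estimate of the form |F s| ≤ m / D can be used without
-- dividing. In the induction, what `F zero` covers is removed from `A` before the remaining indices
-- are treated, so the sets `F s` may overlap.
union-bound : ∀ {k n} D m (C : Subset k) (F : Fin k → Subset n) (A : Subset n) →
  (∀ {z} → z ∈ A → ∃[ s ] s ∈ C × z ∈ F s) → (∀ {s} → s ∈ C → D ℕ.* ∣ F s ∣ ≤ m) →
  D ℕ.* ∣ A ∣ ≤ ∣ C ∣ ℕ.* m
union-bound {n = n} D m [] F A cover _ = ℕ.≤-reflexive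
  (trans (cong (D ℕ.*_) (trans (cong ∣_∣ (Empty-unique λ (z , z∈A) → empty z∈A)) (∣⊥∣≡0 n))) (ℕ.*-zeroʳ D))
  where
  empty : ∀ {z} → z ∉ A
  empty z∈A with () , _ ← cover z∈A
union-bound D m (outside ∷ C) F A cover small = union-bound D m C (F ∘ suc) A cover′ (small ∘ there)
  where
  cover′ : ∀ {z} → z ∈ A → ∃[ s ] s ∈ C × z ∈ F (suc s)
  cover′ z∈A with suc s , there s∈C , z∈Fs ← cover z∈A = s , s∈C , z∈Fs
union-bound D m (inside ∷ C) F A cover small = begin
  D ℕ.* ∣ A ∣                          ≡⟨ cong (D ℕ.*_) (∣p∩q∣+∣q─p∣≡∣q∣ F₀ A) ⟨
  D ℕ.* (∣ F₀ ∩ A ∣ ℕ.+ ∣ A′ ∣)        ≡⟨ ℕ.*-distribˡ-+ D ∣ F₀ ∩ A ∣ ∣ A′ ∣ ⟩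
  D ℕ.* ∣ F₀ ∩ A ∣ ℕ.+ D ℕ.* ∣ A′ ∣    ≤⟨ ℕ.+-mono-≤
    (ℕ.≤-trans (ℕ.*-monoʳ-≤ D (∣p∩q∣≤∣p∣ F₀ A)) (small here))
    (union-bound D m C (F ∘ suc) A′ cover′ (small ∘ there)) ⟩
  m ℕ.+ ∣ C ∣ ℕ.* m                    ∎
  where
  open ℕ.≤-Reasoning
  F₀ = F zero
  A′ = A Subset.─ F₀
  cover′ : ∀ {z} → z ∈ A′ → ∃[ s ] s ∈ C × z ∈ F (suc s)
  cover′ z∈A′ with cover (p─q⊆p A F₀ z∈A′)
  ... | zero  , _         , z∈F₀ = contradiction z∈F₀ (x∈p─q⇒x∉q A F₀ z∈A′)
  ... | suc s , there s∈C , z∈Fs = s , s∈C , z∈Fs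

-- Blocks

module _ {n : ℕ} (G : Graph n) where
  open Graph G

  induced : Subset n → Subgraph G
  induced S = record
    { V     = S
    ; E     = Within (_∈ S) _~_
    ; E?    = λ x y → (x ~? y) ×-dec (x ∈? S) ×-dec (y ∈? S)
    ; E-sym = Within-sym (_∈ S) _~_ ~-sym
    ; E⇒~   = proj₁
    ; E⇒∈   = proj₁ ∘ proj₂
    }

  -- Replacing a subgraph by the induced one on its vertices only adds edges, which preserves
  -- connectedness before and after deleting a vertex. Blocks can therefore be sought among vertex
  -- sets.
  induced-noCut : ∀ (K : Subgraph G) → IsConnectedWithoutCutVertex K →
    IsConnectedWithoutCutVertex (induced (Subgraph.V K))
  induced-noCut K ((nonempty , connected) , noCut) =
    (nonempty , λ x∈ y∈ → Star.map E⇒ (connected x∈ y∈)) ,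
    λ v (v∈ , x , y , x∈ , y∈ , _ , ¬joined) →
      noCut v (v∈ , x , y , x∈ , y∈ ,
               connected (p─q⊆p (V K) ⁅ v ⁆ x∈) (p─q⊆p (V K) ⁅ v ⁆ y∈) ,
               ¬joined ∘ Star.map (λ (e , x≢v , y≢v) → E⇒ e , x≢v , y≢v))
    where
    open Subgraph
    E⇒ : ∀ {x y} → E K x y → E (induced (V K)) x y
    E⇒ e = E⇒~ K e , E⇒∈ K e , E⇒∈ K (E-sym K e)

  -- Assume that no block contains `S`. Any larger `K` without cut vertex has a strictly larger
  -- vertex set, to which the induction applies, and the resulting block contains `S`. So nothing
  -- exceeds `S`, which is then a block itself. The induction terminates since the vertex set is
  -- finite.
  extendToBlock : ∀ S → IsConnectedWithoutCutVertex (induced S) →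
    ¬ ¬ (∃[ T ] S ⊆ T × IsBlock (induced T))
  extendToBlock S = go S (⊃-wellFounded S)
    where
    open Subgraph
    go : ∀ S → Acc _⊃_ S → IsConnectedWithoutCutVertex (induced S) →
      ¬ ¬ (∃[ T ] S ⊆ T × IsBlock (induced T))
    go S (acc rec) noCut k = k (S , id , noCut , maximal)
      where
      V⊆ : ∀ K → IsConnectedWithoutCutVertex K → S ⊆ V K → V K ⊆ S
      V⊆ K noCutK S⊆K {x} x∈K with x ∈? S
      ... | yes x∈S = x∈S
      ... | no  x∉S = ⊥-elim (go (V K) (rec (S⊆K , x , x∈K , x∉S)) (induced-noCut K noCutK)
                        λ (T , K⊆T , block) → k (T , K⊆T ∘ S⊆K , block))
      maximal : ∀ K → IsConnectedWithoutCutVertex K → induced S ⊑ K → K ⊑ induced S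
      maximal K noCutK (S⊆K , _) = V⊆ K noCutK S⊆K , λ e →
        E⇒~ K e , V⊆ K noCutK S⊆K (E⇒∈ K e) , V⊆ K noCutK S⊆K (E⇒∈ K (E-sym K e))

  clique-noCut : ∀ S → Nonempty S → (∀ {x y} → x ∈ S → y ∈ S → x ≢ y → x ~ y) →
    IsConnectedWithoutCutVertex (induced S)
  clique-noCut S nonempty clique = (nonempty , joined) , λ v (_ , x , y , x∈ , y∈ , _ , ¬joined) →
    ¬joined (joined─ v x∈ y∈)
    where
    joined : ∀ {x y} → x ∈ S → y ∈ S → Joined (induced S) x y
    joined {x} {y} x∈ y∈ with x ≟ y
    ... | yes refl = Star.ε
    ... | no  x≢y  = (clique x∈ y∈ x≢y , x∈ , y∈) ◅ Star.ε
    joined─ : ∀ v {x y} → x ∈ S Subset.- v → y ∈ S Subset.- v →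
      Star (Within (_≢ v) (Within (_∈ S) _~_)) x y
    joined─ v {x} {y} x∈ y∈ with x ≟ y
    ... | yes refl = Star.ε
    ... | no  x≢y  =
      ((clique x∈S y∈S x≢y , x∈S , y∈S) , x∈p-y⇒x≢y S x∈ , x∈p-y⇒x≢y S y∈) ◅ Star.ε
      where
      x∈S : x ∈ S
      x∈S = p─q⊆p S ⁅ v ⁆ x∈
      y∈S : y ∈ S
      y∈S = p─q⊆p S ⁅ v ⁆ y∈

  -- A clique has no cut vertex and so extends to a block; that the block exists only up to double
  -- negation does no harm, as `≤` on the naturals is decidable.
  clique-size : ∀ {B} → IsMaxBlockSize G B → ∀ S → Nonempty S →
    (∀ {x y} → x ∈ S → y ∈ S → x ≢ y → x ~ y) → ∣ S ∣ ≤ B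
  clique-size {B} (_ , maxB) S nonempty clique with ∣ S ∣ ℕ.≤? B
  ... | yes S≤B = S≤B
  ... | no  S≰B = ⊥-elim (extendToBlock S (clique-noCut S nonempty clique) λ (T , S⊆T , block) →
                    S≰B (ℕ.≤-trans (p⊆q⇒∣p∣≤∣q∣ S⊆T) (maxB (induced T , block , refl))))

  -- Being joined in `G - v`. The condition sits on the edges of the walk, so the empty walk is the
  -- only one that starts or ends at `v`.
  JoinedAvoiding : Fin n → Rel (Fin n) 0ℓ
  JoinedAvoiding v = Star (Within (_≢ v) _~_)

  JoinedAvoiding-sym : ∀ v → Symmetric (JoinedAvoiding v)
  JoinedAvoiding-sym v = Star.reverse (Within-sym (_≢ v) _~_ ~-sym)

  -- `S` is the vertex set of the cycle closed up by `v`. If `v` is deleted, the path `p` still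
  -- connects the rest. If another vertex `w` is deleted, every remaining vertex of `p` reaches an
  -- end of `p` without meeting `w`, and from there `v`.
  cycle-noCut : ∀ {v x y} → v ~ x → v ~ y → (p : JoinedAvoiding v x y) → IsSimple p → ∀ S →
    v ∈ S → (∀ {u} → u ∈ʷ p → u ∈ S) → (∀ {u} → u ∈ S → u ≡ v ⊎ u ∈ʷ p) →
    IsConnectedWithoutCutVertex (induced S)
  cycle-noCut {v} {x} {y} v~x v~y p simple S v∈S p⊆S S⊆ =
    ((v , v∈S) , λ a∈ b∈ → joined a∈ ◅◅ Star.reverse (Subgraph.E-sym (induced S)) (joined b∈)) ,
    λ w (_ , a , b , a∈ , b∈ , _ , ¬joined) →
      ¬joined (joined─ w (p─q⊆p S ⁅ w ⁆ a∈) (x∈p-y⇒x≢y S a∈) (p─q⊆p S ⁅ w ⁆ b∈) (x∈p-y⇒x≢y S b∈))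
    where
    p∌v : ∀ {u} → u ∈ʷ p → u ≢ v
    p∌v u∈p with q , _ ← suffix p u∈p =
      -- The walk `q` ends at `y`, which differs from `v` as a neighbour of it; read backwards, `q`
      -- carries this property to `u`.
      within-target (_≢ v) (JoinedAvoiding-sym v q) λ { refl → ~-irrefl v~y }

    joined : ∀ {u} → u ∈ S → Joined (induced S) u v
    joined u∈S with S⊆ u∈S
    ... | inj₁ refl = Star.ε
    ... | inj₂ u∈p with q , q⊆p , _ ← suffix p u∈p =
      Star.map (λ ((e , _) , a∈ , b∈) → e , a∈ , b∈) (within {P = _∈ S} q (p⊆S ∘ q⊆p)) ◅◅
      (~-sym v~y , p⊆S (target∈ p) , v∈S) ◅ Star.ε

    E─ : Fin n → Rel (Fin n) 0ℓ
    E─ w = Within (_≢ w) (Within (_∈ S) _~_)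

    weaken : ∀ {w a b} → Star (Within (λ u → u ∈ S × u ≢ w) (Within (_≢ v) _~_)) a b → Star (E─ w) a b
    weaken = Star.map λ ((e , _) , (a∈ , a≢w) , b∈ , b≢w) → (e , a∈ , b∈) , a≢w , b≢w

    joined-y : ∀ {u} → u ∈ S → u ≢ v → Star (E─ v) u y
    joined-y u∈S u≢v with S⊆ u∈S
    ... | inj₁ u≡v = contradiction u≡v u≢v
    ... | inj₂ u∈p with q , q⊆p , _ ← suffix p u∈p =
      weaken (within q λ z∈q → p⊆S (q⊆p z∈q) , p∌v (q⊆p z∈q))

    joined-v : ∀ {w u} → w ≢ v → u ∈ S → u ≢ w → Star (E─ w) u v
    joined-v {w} w≢v u∈S u≢w with S⊆ u∈S
    ... | inj₁ refl = Star.ε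
    ... | inj₂ u∈p with simple-ends _≟_ (Within-sym (_≢ v) _~_ ~-sym) {P = λ z → z ∈ S × z ≢ w} p simple
                          (λ z∈p z≢w → p⊆S z∈p , z≢w) u∈p u≢w
    ...   | inj₁ u→x = let x∈S , x≢w = within-target (λ z → z ∈ S × z ≢ w) u→x (u∈S , u≢w) in
      weaken u→x ◅◅ ((~-sym v~x , x∈S , v∈S) , x≢w , w≢v ∘ sym) ◅ Star.ε
    ...   | inj₂ u→y = let y∈S , y≢w = within-target (λ z → z ∈ S × z ≢ w) u→y (u∈S , u≢w) in
      weaken u→y ◅◅ ((~-sym v~y , y∈S , v∈S) , y≢w , w≢v ∘ sym) ◅ Star.ε

    joined─ : ∀ w {a b} → a ∈ S → a ≢ w → b ∈ S → b ≢ w → Star (E─ w) a b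
    joined─ w a∈ a≢w b∈ b≢w with w ≟ v
    ... | yes refl = joined-y a∈ a≢w ◅◅ Star.reverse (Subgraph.E-sym (induced S ─ w)) (joined-y b∈ b≢w)
    ... | no  w≢v  = joined-v w≢v a∈ a≢w ◅◅
                     Star.reverse (Subgraph.E-sym (induced S ─ w)) (joined-v w≢v b∈ b≢w)

  -- Consequences of the completeness of blocks

  module _ (blockGraph : IsBlockGraph G) where

    neighbours-adjacent : ∀ {v x y} → v ~ x → v ~ y → x ≢ y → JoinedAvoiding v x y → x ~ y
    neighbours-adjacent {v} {x} {y} v~x v~y x≢y j with x ~? y
    ... | yes x~y = x~y
    -- Adjacency is decidable, so the goal here is absurdity and a block through the cycle may be
    -- used although it exists only up to double negation.
    ... | no ¬x~y with p , simple ← simplify _≟_ j = ⊥-elim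
      (extendToBlock S
        (cycle-noCut v~x v~y p simple S
          (∈-comprehension⁺ S? (inj₁ refl)) (∈-comprehension⁺ S? ∘ inj₂) (∈-comprehension⁻ S?))
        λ (T , S⊆T , block) → ¬x~y (proj₁ (proj₂ blockGraph (induced T) block
          (S⊆T (∈-comprehension⁺ S? (inj₂ (source∈ p))))
          (S⊆T (∈-comprehension⁺ S? (inj₂ (target∈ p)))) x≢y)))
      where
      S? : Decidable (λ u → u ≡ v ⊎ u ∈ʷ p)
      S? u = (u ≟ v) ⊎-dec (_∈ʷ?_ _≟_ u p)
      S : Subset n
      S = comprehension S?

    module _ (joined? : ∀ v x y → Dec (JoinedAvoiding v x y)) where

      -- If z remains joined to t once s is deleted, then t is adjacent to the vertex after s on
      -- the path, so s can be skipped.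
      gate : ∀ {t z s} → t ~ s → (p : Star _~_ s z) → ¬ t ∈ʷ p → IsSimple p →
        ∃[ s ] t ~ s × JoinedAvoiding t s z × (z ≡ s ⊎ ¬ JoinedAvoiding s z t)
      gate {s = s} t~s Star.ε _ _ = s , t~s , Star.ε , inj₁ refl
      gate {t} {z} {s} t~s (s~u ◅ p) t∉ (s∉p , simple) with joined? s z t
      ... | no  ¬z→t = s , t~s , within (s~u ◅ p) (λ { v∈ refl → t∉ v∈ }) , inj₂ ¬z→t
      ... | yes z→t  = gate (~-sym u~t) p (t∉ ∘ inj₂) simple
        where
        u→z : JoinedAvoiding s _ z
        u→z = within p λ { v∈ refl → s∉p v∈ }
        u~t = neighbours-adjacent s~u (~-sym t~s) (λ { refl → t∉ (inj₂ (source∈ p)) }) (u→z ◅◅ z→t)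

-- Subtrees below a root leaf

module _ {n : ℕ} (G : Graph n) where
  open Graph G

  ∈-neighbours⁺ : ∀ {x y} → x ~ y → y ∈ neighbours x
  ∈-neighbours⁺ {x} = ∈-comprehension⁺ (x ~?_)

  ∈-neighbours⁻ : ∀ {x y} → y ∈ neighbours x → x ~ y
  ∈-neighbours⁻ {x} = ∈-comprehension⁻ (x ~?_)

  leaf-degree : ∀ {x} → x ∈ leafSet → degree x ≡ 1
  leaf-degree = ∈-comprehension⁻ (λ x → degree x ℕ.≟ 1)

  leaf-neighbour-unique : ∀ {x y z} → degree x ≡ 1 → x ~ y → x ~ z → y ≡ z
  leaf-neighbour-unique {x} {y} {z} deg≡1 x~y x~z with y ≟ z
  ... | yes y≡z = y≡z
  ... | no  y≢z = contradiction
    (subst₂ ℕ._<_ (∣⁅x⁆∣≡1 y) deg≡1 (p⊂q⇒∣p∣<∣q∣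
      ((λ u∈ → subst (_∈ neighbours x) (sym (x∈⁅y⁆⇒x≡y y u∈)) (∈-neighbours⁺ x~y)) ,
       z , ∈-neighbours⁺ x~z , λ z∈ → y≢z (sym (x∈⁅y⁆⇒x≡y y z∈)))))
    (ℕ.<-irrefl refl)

  module _ (blockGraph : IsBlockGraph G)
           (joined? : ∀ v x y → Dec (JoinedAvoiding G v x y)) (r : Fin n) where

    walk : ∀ x y → Star _~_ x y
    walk x y = proj₂ (proj₁ blockGraph) ∈⊤ ∈⊤

    Below : Fin n → Pred (Fin n) 0ℓ
    Below t z = z ≡ t ⊎ ¬ JoinedAvoiding G t z r

    below? : ∀ t → Decidable (Below t)
    below? t z = (z ≟ t) ⊎-dec ¬? (joined? t z r)

    subtree : Fin n → Subset n
    subtree t = comprehension (below? t)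

    ∈-subtree⁺ : ∀ {t z} → Below t z → z ∈ subtree t
    ∈-subtree⁺ {t} = ∈-comprehension⁺ (below? t)

    ∈-subtree⁻ : ∀ {t z} → z ∈ subtree t → Below t z
    ∈-subtree⁻ {t} = ∈-comprehension⁻ (below? t)

    ∉-subtree : ∀ {t z} → z ∉ subtree t → z ≢ t × JoinedAvoiding G t z r
    ∉-subtree {t} {z} z∉ with z ≟ t | joined? t z r
    ... | yes z≡t | _     = contradiction (∈-subtree⁺ (inj₁ z≡t)) z∉
    ... | no  _   | no ¬j = contradiction (∈-subtree⁺ (inj₂ ¬j)) z∉
    ... | no  z≢t | yes j = z≢t , j

    -- Every walk from `z` to the root passes through `t`; its initial part up to `t` inherits the
    -- avoidance of `s`.
    below-through : ∀ {s t z} → Below t z → JoinedAvoiding G s z r → JoinedAvoiding G s z t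
    below-through         (inj₁ refl) _ = Star.ε
    below-through {t = t} (inj₂ ¬j)   p with _∈ʷ?_ _≟_ t p
    ... | yes t∈p = prefix p t∈p
    ... | no  t∉p = contradiction
      (Star.map (λ ((e , _) , a≢t , b≢t) → e , a≢t , b≢t)
                (within {P = _≢ t} p λ { v∈p refl → t∉p v∈p })) ¬j

    -- The witness is the vertex found by `gate`. It lies below `t` because it is joined to `z` in
    -- `G - t`, and `z` is cut off from the root there. It has `z` below it because a walk from `z`
    -- to the root avoiding `s` would have to reach `t` on its way, while `s` separates `z` from
    -- `t`.
    below-child : ∀ {t z} → Below t z → z ≢ t → ∃[ s ] t ~ s × Below t s × Below s z
    below-child {t} {z} below z≢t with simplify _≟_ (walk t z)
    ... | Star.ε     , _          = contradiction refl z≢t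
    ... | e ◅ p , t∉p , simple with gate G blockGraph joined? e p t∉p simple
    ...   | s , t~s , s→z , z≡s⊎ =
      s , t~s ,
      inj₂ (λ s→r → [ z≢t , (λ ¬z→r → ¬z→r (JoinedAvoiding-sym G t s→z ◅◅ s→r)) ]′ below) ,
      [ inj₁ , (λ ¬z→t → inj₂ (¬z→t ∘ below-through below)) ]′ z≡s⊎

    parent : ∀ {t} → t ≢ r → ∃[ u ] t ~ u × ¬ Below t u
    parent {t} t≢r with simplify _≟_ (walk t r)
    ... | Star.ε      , _       = contradiction refl t≢r
    ... | _◅_ {_} {u} e p , t∉p , _ = u , e , λ
      { (inj₁ refl) → ~-irrefl e
      ; (inj₂ ¬j)   → ¬j (within p λ { v∈p refl → t∉p v∈p }) }

    root∉subtree : ∀ {t} → t ≢ r → ¬ Below t r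
    root∉subtree t≢r (inj₁ r≡t) = t≢r (sym r≡t)
    root∉subtree t≢r (inj₂ ¬j)  = ¬j Star.ε

    -- If `z` below `s` escaped to the root without `t`, its walk would pass through `s`, and `s`
    -- would escape too. Strictness, needed for the descent to terminate, is witnessed by `t`.
    subtree-child : ∀ {s t} → t ≢ r → t ~ s → Below t s → subtree s ⊂ subtree t
    subtree-child t≢r t~s (inj₁ refl) = contradiction t~s ~-irrefl
    subtree-child {s} {t} t≢r t~s (inj₂ ¬s→r) =
      (λ z∈ → ∈-subtree⁺ (inj₂ λ z→r →
         ¬s→r (JoinedAvoiding-sym G t (below-through (∈-subtree⁻ z∈) z→r) ◅◅ z→r))) ,
      t , ∈-subtree⁺ (inj₁ refl) , λ t∈ → ¬below (∈-subtree⁻ t∈)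
      where
      -- A simple path from `t` to the root cannot contain `s`: its part from `s` onwards would
      -- avoid `t`, whereas `t` cuts `s` off from the root.
      t→r : JoinedAvoiding G s t r
      t→r with simplify _≟_ (walk t r)
      ... | p , simple with _∈ʷ?_ _≟_ s p
      ...   | no  s∉p = within p λ { v∈p refl → s∉p v∈p }
      t→r | Star.ε , _ | yes _ = contradiction refl t≢r
      t→r | _ ◅ _ , _ | yes (inj₁ refl) = contradiction t~s ~-irrefl
      t→r | _ ◅ p , t∉p , _ | yes (inj₂ s∈p) with q , q⊆p , _ ← suffix p s∈p =
        contradiction (within q λ { v∈q refl → t∉p (q⊆p v∈q) }) ¬s→r
      ¬below : ¬ Below s t
      ¬below (inj₁ refl) = ~-irrefl t~s
      ¬below (inj₂ ¬j)   = ¬j t→r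

    subtree-exit : ∀ {t x y} → x ~ y → x ∈ subtree t → y ∉ subtree t → x ≡ t
    subtree-exit {t} {x} x~y x∈ y∉ with x ≟ t | ∈-subtree⁻ x∈ | ∉-subtree y∉
    ... | yes x≡t | _        | _          = x≡t
    ... | no  x≢t | inj₁ x≡t | _          = x≡t
    ... | no  x≢t | inj₂ ¬j  | y≢t , y→r = contradiction ((x~y , x≢t , y≢t) ◅ y→r) ¬j

    exits : Fin n → Subset n
    exits t = neighbours t Subset.─ subtree t

    ∈-exits⁻ : ∀ {t y} → y ∈ exits t → t ~ y × JoinedAvoiding G t y r
    ∈-exits⁻ {t} y∈ = ∈-neighbours⁻ (p─q⊆p (neighbours t) (subtree t) y∈) ,
      proj₂ (∉-subtree (x∈p─q⇒x∉q (neighbours t) (subtree t) y∈))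

    -- Any two exits are joined in `G - t` by way of the root, hence adjacent. Together with `t`
    -- they form a clique, and the extra vertex `t` accounts for B - 1 in place of B.
    ∣exits∣<B : ∀ {B} → IsMaxBlockSize G B → ∀ t → ∣ exits t ∣ ℕ.< B
    ∣exits∣<B maxB t = ℕ.≤-trans
      (p⊂q⇒∣p∣<∣q∣ (q⊆p∪q ⁅ t ⁆ (exits t) , t , x∈p∪q⁺ (inj₁ (x∈⁅x⁆ t)) ,
                    λ t∈ → ~-irrefl (proj₁ (∈-exits⁻ t∈))))
      (clique-size G maxB (⁅ t ⁆ ∪ exits t) (t , x∈p∪q⁺ (inj₁ (x∈⁅x⁆ t))) clique)
      where
      clique : ∀ {x y} → x ∈ ⁅ t ⁆ ∪ exits t → y ∈ ⁅ t ⁆ ∪ exits t → x ≢ y → x ~ y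
      clique x∈ y∈ x≢y with x∈p∪q⁻ ⁅ t ⁆ (exits t) x∈ | x∈p∪q⁻ ⁅ t ⁆ (exits t) y∈
      ... | inj₁ x∈t | inj₁ y∈t = contradiction (trans (x∈⁅y⁆⇒x≡y t x∈t) (sym (x∈⁅y⁆⇒x≡y t y∈t))) x≢y
      ... | inj₁ x∈t | inj₂ y∈e rewrite x∈⁅y⁆⇒x≡y t x∈t = proj₁ (∈-exits⁻ y∈e)
      ... | inj₂ x∈e | inj₁ y∈t rewrite x∈⁅y⁆⇒x≡y t y∈t = ~-sym (proj₁ (∈-exits⁻ x∈e))
      ... | inj₂ x∈e | inj₂ y∈e with t~x , x→r ← ∈-exits⁻ x∈e | t~y , y→r ← ∈-exits⁻ y∈e =
        neighbours-adjacent G blockGraph t~x t~y x≢y (x→r ◅◅ JoinedAvoiding-sym G t y→r)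

    children : Fin n → Subset n
    children t = neighbours t ∩ subtree t

    -- The second vertex of a simple path from `t` to the root is a neighbour of `t` outside the
    -- subtree.
    ∣children∣<degree : ∀ {t} → t ≢ r → ∣ children t ∣ ℕ.< degree t
    ∣children∣<degree {t} t≢r with u , t~u , ¬below ← parent t≢r = p⊂q⇒∣p∣<∣q∣
      (p∩q⊆p (neighbours t) (subtree t) , u , ∈-neighbours⁺ t~u ,
       λ u∈ → ¬below (∈-subtree⁻ (proj₂ (x∈p∩q⁻ (neighbours t) (subtree t) u∈))))

    -- Finding a balanced subtree

    module _ {D} (maxD : IsMaxDegree G D) (2≤D : 2 ≤ D) (δΩ : Subset n)
             (2≤∣δΩ∣ : 2 ≤ ∣ δΩ ∣) (δΩ⊆leaves : δΩ ⊆ leafSet) where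

      Balanced : Pred (Subset n) 0ℓ
      Balanced T = ∣ δΩ ∣ ≤ D ℕ.* ∣ T ∩ δΩ ∣ × ∣ δΩ ∣ ≤ D ℕ.* ∣ δΩ Subset.─ T ∣

      -- At most D - 1 children, each carrying at most |δΩ| / D boundary vertices, leave at least
      -- |δΩ| / D of them outside. The children do not cover `t`, so the case that `t` is itself a
      -- boundary vertex needs a separate argument.
      lightChildren⇒balanced : ∀ {t} → t ≢ r → ∣ δΩ ∣ ≤ D ℕ.* ∣ subtree t ∩ δΩ ∣ →
        (∀ {s} → s ∈ children t → D ℕ.* ∣ subtree s ∩ δΩ ∣ ≤ ∣ δΩ ∣) → Balanced (subtree t)
      lightChildren⇒balanced {t} t≢r heavy light = heavy , outside-heavy (t ∈? δΩ)
        where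
        open ℕ.≤-Reasoning
        T = subtree t
        L w b : ℕ
        L = ∣ δΩ ∣
        w = ∣ T ∩ δΩ ∣
        b = ∣ δΩ Subset.─ T ∣

        cover : ∀ {z} → z ∈ T ∩ δΩ → z ≢ t → ∃[ s ] s ∈ children t × z ∈ subtree s ∩ δΩ
        cover z∈ z≢t with z∈T , z∈δΩ ← x∈p∩q⁻ T δΩ z∈
          with s , t~s , s-below , z-below ← below-child (∈-subtree⁻ z∈T) z≢t =
          s , x∈p∩q⁺ (∈-neighbours⁺ t~s , ∈-subtree⁺ s-below) , x∈p∩q⁺ (∈-subtree⁺ z-below , z∈δΩ)

        outside-heavy : Dec (t ∈ δΩ) → L ≤ D ℕ.* b
        -- A boundary vertex is a leaf whose only neighbour leads to the root, so `t` has no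
        -- children and is the only boundary vertex inside. At least one lies outside, whence
        -- `w ≤ b` and the outside inherits the bound of the inside.
        outside-heavy (yes t∈δΩ) = ℕ.≤-trans heavy (ℕ.*-monoʳ-≤ D (ℕ.≤-trans w≤1 1≤b))
          where
          no-children : ∀ {s} → s ∉ children t
          no-children {s} s∈ = ℕ.n≮0 (ℕ.≤-trans
            (p⊂q⇒∣p∣<∣q∣ (⊥⊆ , s , s∈ , ∉⊥))
            (ℕ.s≤s⁻¹ (subst (∣ children t ∣ ℕ.<_) (leaf-degree (δΩ⊆leaves t∈δΩ)) (∣children∣<degree t≢r))))
          T∩δΩ⊆t : T ∩ δΩ ⊆ ⁅ t ⁆
          T∩δΩ⊆t {z} z∈ with z ≟ t
          ... | yes refl = x∈⁅x⁆ t
          ... | no  z≢t  = let s , s∈ , _ = cover z∈ z≢t in contradiction s∈ no-children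
          w≤1 : w ≤ 1
          w≤1 = subst (w ≤_) (∣⁅x⁆∣≡1 t) (p⊆q⇒∣p∣≤∣q∣ T∩δΩ⊆t)
          1≤b : 1 ≤ b
          1≤b = ℕ.+-cancelˡ-≤ 1 1 b (begin
            2         ≤⟨ 2≤∣δΩ∣ ⟩
            L         ≡⟨ ∣p∩q∣+∣q─p∣≡∣q∣ T δΩ ⟨
            w ℕ.+ b   ≤⟨ ℕ.+-monoˡ-≤ b w≤1 ⟩
            1 ℕ.+ b   ∎)
        -- The children's share is added on both sides so that subtraction of naturals is avoided.
        outside-heavy (no t∉δΩ) = ℕ.+-cancelˡ-≤ (∣ children t ∣ ℕ.* L) L (D ℕ.* b) (begin
          ∣ children t ∣ ℕ.* L ℕ.+ L             ≡⟨ ℕ.+-comm (∣ children t ∣ ℕ.* L) L ⟩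
          ℕ.suc ∣ children t ∣ ℕ.* L             ≤⟨ ℕ.*-monoˡ-≤ L
            (ℕ.≤-trans (∣children∣<degree t≢r) (proj₂ maxD (t , refl))) ⟩
          D ℕ.* L                                ≡⟨ cong (D ℕ.*_) (∣p∩q∣+∣q─p∣≡∣q∣ T δΩ) ⟨
          D ℕ.* (w ℕ.+ b)                        ≡⟨ ℕ.*-distribˡ-+ D w b ⟩
          D ℕ.* w ℕ.+ D ℕ.* b                    ≤⟨ ℕ.+-monoˡ-≤ (D ℕ.* b)
            (union-bound D L (children t) (λ s → subtree s ∩ δΩ) (T ∩ δΩ)
              (λ z∈ → cover z∈ λ { refl → t∉δΩ (proj₂ (x∈p∩q⁻ T δΩ z∈)) }) light) ⟩
          ∣ children t ∣ ℕ.* L ℕ.+ D ℕ.* b       ∎)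

      descend : ∀ t → Acc _⊂_ (subtree t) → t ≢ r → ∣ δΩ ∣ ≤ D ℕ.* ∣ subtree t ∩ δΩ ∣ →
        ∃[ t ] Balanced (subtree t)
      descend t (acc rec) t≢r heavy
        with any? (λ s → (s ∈? children t) ×-dec (∣ δΩ ∣ ℕ.≤? D ℕ.* ∣ subtree s ∩ δΩ ∣))
      ... | no  ¬heavy = t , lightChildren⇒balanced t≢r heavy λ s∈ →
        ℕ.<⇒≤ (ℕ.≰⇒> λ heavy-s → ¬heavy (_ , s∈ , heavy-s))
      ... | yes (s , s∈ , heavy-s) with s∈N , s∈T ← x∈p∩q⁻ (neighbours t) (subtree t) s∈ =
        descend s (rec (subtree-child t≢r (∈-neighbours⁻ s∈N) (∈-subtree⁻ s∈T)))
          (λ { refl → root∉subtree t≢r (∈-subtree⁻ s∈T) }) heavy-s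

      -- The descent starts at the only neighbour of the leaf `r`. Deleting that neighbour isolates
      -- `r`, so its subtree misses no boundary vertex but `r`; since |δΩ| and `D` are at least 2,
      -- this is heavy enough.
      exists-balanced : r ∈ δΩ → ∃[ t ] Balanced (subtree t)
      exists-balanced r∈δΩ = descend r′ (⊂-wellFounded (subtree r′)) (λ r′≡r → ~-irrefl (subst (r ~_) r′≡r r~r′)) heavy
        where
        open ℕ.≤-Reasoning
        deg≡1 : degree r ≡ 1
        deg≡1 = leaf-degree (δΩ⊆leaves r∈δΩ)
        neighbour : Nonempty (neighbours r)
        neighbour = 0<∣p∣⇒Nonempty (neighbours r) (subst (0 ℕ.<_) (sym deg≡1) ℕ.z<s)
        r′ : Fin n
        r′ = proj₁ neighbour
        r~r′ : r ~ r′
        r~r′ = ∈-neighbours⁻ (proj₂ neighbour)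
        w = ∣ subtree r′ ∩ δΩ ∣

        isolated : ∀ {z} → JoinedAvoiding G r′ r z → z ≡ r
        isolated Star.ε                  = refl
        isolated ((r~u , _ , u≢r′) ◅ _) = contradiction (leaf-neighbour-unique deg≡1 r~u r~r′) u≢r′

        cover : δΩ ⊆ ⁅ r ⁆ ∪ (subtree r′ ∩ δΩ)
        cover {z} z∈δΩ with z ≟ r
        ... | yes refl = x∈p∪q⁺ (inj₁ (x∈⁅x⁆ r))
        ... | no  z≢r  = x∈p∪q⁺ (inj₂ (x∈p∩q⁺
          (∈-subtree⁺ (inj₂ (z≢r ∘ isolated ∘ JoinedAvoiding-sym G r′)) , z∈δΩ)))

        L≤1+w : ∣ δΩ ∣ ≤ 1 ℕ.+ w
        L≤1+w = begin
          ∣ δΩ ∣                           ≤⟨ p⊆q⇒∣p∣≤∣q∣ cover ⟩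
          ∣ ⁅ r ⁆ ∪ (subtree r′ ∩ δΩ) ∣    ≤⟨ ∣p∪q∣≤∣p∣+∣q∣ ⁅ r ⁆ (subtree r′ ∩ δΩ) ⟩
          ∣ ⁅ r ⁆ ∣ ℕ.+ w                  ≡⟨ cong (ℕ._+ w) (∣⁅x⁆∣≡1 r) ⟩
          1 ℕ.+ w                          ∎

        heavy : ∣ δΩ ∣ ≤ D ℕ.* w
        heavy = begin
          ∣ δΩ ∣     ≤⟨ L≤1+w ⟩
          1 ℕ.+ w    ≤⟨ ℕ.+-monoˡ-≤ w (ℕ.s≤s⁻¹ (ℕ.≤-trans 2≤∣δΩ∣ L≤1+w)) ⟩
          w ℕ.+ w    ≡⟨ cong (w ℕ.+_) (ℕ.+-identityʳ w) ⟨
          2 ℕ.* w    ≤⟨ ℕ.*-monoˡ-≤ w 2≤D ⟩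
          D ℕ.* w    ∎

-- Rational inequalities

abstract
  2halves : ∀ ε → ε ℚ.* ½ ℚ.+ ε ℚ.* ½ ≡ ε
  2halves ε = trans (sym (ℚ.*-distribˡ-+ ε ½ ½)) (ℚ.*-identityʳ ε)

  half>0 : ∀ {ε} → 0ℚ ℚ.< ε → 0ℚ ℚ.< ε ℚ.* ½
  half>0 {ε} 0<ε = ℚ.positive⁻¹ (ε ℚ.* ½) {{ℚ.pos*pos⇒pos ε {{ℚ.positive 0<ε}} ½}}

  half≤ : ∀ {ε} → 0ℚ ℚ.< ε → ε ℚ.* ½ ℚ.≤ ε
  half≤ {ε} 0<ε =
    subst₂ ℚ._≤_ (ℚ.+-identityʳ _) (2halves ε) (ℚ.+-monoʳ-≤ (ε ℚ.* ½) (ℚ.<⇒≤ (half>0 0<ε)))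

  p≤∣p∣ : ∀ p → p ℚ.≤ ℚ.∣ p ∣
  p≤∣p∣ p with ℚ.≤-total 0ℚ p
  ... | inj₁ 0≤p = ℚ.≤-reflexive (sym (ℚ.0≤p⇒∣p∣≡p 0≤p))
  ... | inj₂ p≤0 = ℚ.≤-trans p≤0 (ℚ.0≤∣p∣ p)

  *>0 : ∀ {p q} → 0ℚ ℚ.< p → 0ℚ ℚ.< q → 0ℚ ℚ.< p ℚ.* q
  *>0 {p} {q} 0<p 0<q = ℚ.positive⁻¹ (p ℚ.* q) {{ℚ.pos*pos⇒pos p {{ℚ.positive 0<p}} q {{ℚ.positive 0<q}}}}

  *≥0 : ∀ {p q} → 0ℚ ℚ.≤ p → 0ℚ ℚ.≤ q → 0ℚ ℚ.≤ p ℚ.* q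
  *≥0 {p} {q} 0≤p 0≤q = ℚ.nonNegative⁻¹ (p ℚ.* q)
    {{ℚ.nonNeg*nonNeg⇒nonNeg p {{ℚ.nonNegative 0≤p}} q {{ℚ.nonNegative 0≤q}}}}

  square≡∣∣² : ∀ p → p ℚ.* p ≡ ℚ.∣ p ∣ ℚ.* ℚ.∣ p ∣
  square≡∣∣² p with ℚ.∣p∣≡p∨∣p∣≡-p p
  ... | inj₁ eq rewrite eq = refl
  ... | inj₂ eq rewrite eq = solve 1 (λ x → x :* x := (:- x) :* (:- x)) refl p
    where open +-*-Solver

  square≥0 : ∀ p → 0ℚ ℚ.≤ p ℚ.* p
  square≥0 p = subst (0ℚ ℚ.≤_) (sym (square≡∣∣² p)) (*≥0 (ℚ.0≤∣p∣ p) (ℚ.0≤∣p∣ p))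

  reciprocal : ∀ {p} → 0ℚ ℚ.< p → ∃[ q ] 0ℚ ℚ.< q × q ℚ.* p ≡ 1ℚ
  reciprocal {p} 0<p =
    ℚ.1/_ p {{p≢0}} , ℚ.positive⁻¹ _ {{ℚ.1/pos⇒pos p {{ℚ.positive 0<p}}}} , ℚ.*-inverseˡ p {{p≢0}}
    where
    p≢0 : ℚ.NonZero p
    p≢0 = ℚ.pos⇒nonZero p {{ℚ.positive 0<p}}

  *-mono-≤ˡ : ∀ {p q r} → 0ℚ ℚ.≤ r → p ℚ.≤ q → r ℚ.* p ℚ.≤ r ℚ.* q
  *-mono-≤ˡ {r = r} 0≤r = ℚ.*-monoˡ-≤-nonNeg r {{ℚ.nonNegative 0≤r}}

  *-mono-≤ʳ : ∀ {p q r} → 0ℚ ℚ.≤ r → p ℚ.≤ q → p ℚ.* r ℚ.≤ q ℚ.* r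
  *-mono-≤ʳ {r = r} 0≤r = ℚ.*-monoʳ-≤-nonNeg r {{ℚ.nonNegative 0≤r}}

  square-cancel-≤ : ∀ {p q} → 0ℚ ℚ.≤ q → p ℚ.* p ℚ.≤ q ℚ.* q → ℚ.∣ p ∣ ℚ.≤ q
  square-cancel-≤ {p} {q} 0≤q p²≤q² = ℚ.≮⇒≥ λ q<∣p∣ →
    ℚ.<-irrefl refl (ℚ.<-≤-trans (q²<p² q<∣p∣) p²≤q²)
    where
    q²<p² : q ℚ.< ℚ.∣ p ∣ → q ℚ.* q ℚ.< p ℚ.* p
    q²<p² q<∣p∣ = subst (q ℚ.* q ℚ.<_) (sym (square≡∣∣² p)) (ℚ.≤-<-trans
      (*-mono-≤ˡ 0≤q (ℚ.<⇒≤ q<∣p∣))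
      (ℚ.*-monoˡ-<-pos ℚ.∣ p ∣ {{ℚ.positive (ℚ.≤-<-trans 0≤q q<∣p∣)}} q<∣p∣))

-- Null sequences: by definition x ≈ℝ y says that the difference sequence is null.

Null : (ℕ → ℚ) → Set
Null s = Eventually λ ε n → ℚ.∣ s n ∣ ℚ.≤ ε

Bounded : (ℕ → ℚ) → Set
Bounded s = ∃₂ λ N K → 0ℚ ℚ.< K × (∀ n → N ℕ.≤ n → ℚ.∣ s n ∣ ℚ.≤ K)

abstract
  null-≗ : ∀ {s t} → (∀ n → s n ≡ t n) → Null s → Null t
  null-≗ s≗t s0 ε 0<ε with N , h ← s0 ε 0<ε = N , λ n n≥ →
    subst (λ q → ℚ.∣ q ∣ ℚ.≤ ε) (s≗t n) (h n n≥)

  null-0 : Null (λ _ → 0ℚ)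
  null-0 ε 0<ε = 0 , λ _ _ → ℚ.<⇒≤ 0<ε

  null-neg : ∀ {s} → Null s → Null (λ n → ℚ.- s n)
  null-neg {s} s0 ε 0<ε with N , h ← s0 ε 0<ε = N , λ n n≥ →
    subst (ℚ._≤ ε) (sym (ℚ.∣-p∣≡∣p∣ (s n))) (h n n≥)

  null-+ : ∀ {s t} → Null s → Null t → Null (λ n → s n ℚ.+ t n)
  null-+ {s} {t} s0 t0 ε 0<ε
    with M , hs ← s0 (ε ℚ.* ½) (half>0 0<ε) | N , ht ← t0 (ε ℚ.* ½) (half>0 0<ε) =
    M ℕ.⊔ N , λ n n≥ → begin
      ℚ.∣ s n ℚ.+ t n ∣          ≤⟨ ℚ.∣p+q∣≤∣p∣+∣q∣ (s n) (t n) ⟩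
      ℚ.∣ s n ∣ ℚ.+ ℚ.∣ t n ∣    ≤⟨ ℚ.+-mono-≤ (hs n (ℕ.m⊔n≤o⇒m≤o M N n≥)) (ht n (ℕ.m⊔n≤o⇒n≤o M N n≥)) ⟩
      ε ℚ.* ½ ℚ.+ ε ℚ.* ½        ≡⟨ 2halves ε ⟩
      ε                          ∎
    where open ℚ.≤-Reasoning

  null-*-bounded : ∀ {s t} → Null s → Bounded t → Null (λ n → s n ℚ.* t n)
  null-*-bounded {s} {t} s0 (M , K , 0<K , ht) ε 0<ε
    with K⁻¹ , 0<K⁻¹ , eq ← reciprocal 0<K
    with N , hs ← s0 (ε ℚ.* K⁻¹) (*>0 0<ε 0<K⁻¹) =
    M ℕ.⊔ N , λ n n≥ → begin
      ℚ.∣ s n ℚ.* t n ∣           ≡⟨ ℚ.∣p*q∣≡∣p∣*∣q∣ (s n) (t n) ⟩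
      ℚ.∣ s n ∣ ℚ.* ℚ.∣ t n ∣     ≤⟨ *-mono-≤ʳ (ℚ.0≤∣p∣ (t n)) (hs n (ℕ.m⊔n≤o⇒n≤o M N n≥)) ⟩
      ε ℚ.* K⁻¹ ℚ.* ℚ.∣ t n ∣     ≤⟨ *-mono-≤ˡ (ℚ.<⇒≤ (*>0 0<ε 0<K⁻¹)) (ht n (ℕ.m⊔n≤o⇒m≤o M N n≥)) ⟩
      ε ℚ.* K⁻¹ ℚ.* K             ≡⟨ ℚ.*-assoc ε K⁻¹ K ⟩
      ε ℚ.* (K⁻¹ ℚ.* K)           ≡⟨ cong (ε ℚ.*_) eq ⟩
      ε ℚ.* 1ℚ                    ≡⟨ ℚ.*-identityʳ ε ⟩
      ε                           ∎
    where open ℚ.≤-Reasoning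

  -- Asking for accuracy `ε * ε` in `t` avoids square roots. In this way a null norm will force null
  -- coefficients.
  null-sqrt : ∀ {s t} → (∀ n → s n ℚ.* s n ℚ.≤ t n) → Null t → Null s
  null-sqrt {s} {t} s²≤t t0 ε 0<ε with N , h ← t0 (ε ℚ.* ε) (*>0 0<ε 0<ε) = N , λ n n≥ →
    square-cancel-≤ (ℚ.<⇒≤ 0<ε)
      (ℚ.≤-trans (s²≤t n) (subst (ℚ._≤ ε ℚ.* ε)
        (ℚ.0≤p⇒∣p∣≡p (ℚ.≤-trans (square≥0 (s n)) (s²≤t n))) (h n n≥)))

  null-squeeze : ∀ {s t} → (∃[ N ] ∀ n → N ℕ.≤ n → 0ℚ ℚ.≤ s n × s n ℚ.≤ t n) → Null t → Null s
  null-squeeze {s} {t} (M , h) t0 ε 0<ε with N , ht ← t0 ε 0<ε = M ℕ.⊔ N , λ n n≥ →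
    let 0≤s , s≤t = h n (ℕ.m⊔n≤o⇒m≤o M N n≥) in begin
      ℚ.∣ s n ∣    ≡⟨ ℚ.0≤p⇒∣p∣≡p 0≤s ⟩
      s n          ≤⟨ s≤t ⟩
      t n          ≡⟨ ℚ.0≤p⇒∣p∣≡p (ℚ.≤-trans 0≤s s≤t) ⟨
      ℚ.∣ t n ∣    ≤⟨ ht n (ℕ.m⊔n≤o⇒n≤o M N n≥) ⟩
      ε            ∎
    where open ℚ.≤-Reasoning

  cauchy-bounded : ∀ x → Bounded (seq x)
  cauchy-bounded x with N , h ← cauchy x 1ℚ (ℚ.positive⁻¹ 1ℚ) =
    N , 1ℚ ℚ.+ ℚ.∣ seq x N ∣ , ℚ.+-mono-<-≤ (ℚ.positive⁻¹ 1ℚ) (ℚ.0≤∣p∣ (seq x N)) , λ n n≥ → begin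
      ℚ.∣ seq x n ∣
        ≡⟨ cong ℚ.∣_∣ (solve 2 (λ a b → a := (a :- b) :+ b) refl (seq x n) (seq x N)) ⟩
      ℚ.∣ (seq x n ℚ.- seq x N) ℚ.+ seq x N ∣
        ≤⟨ ℚ.∣p+q∣≤∣p∣+∣q∣ (seq x n ℚ.- seq x N) (seq x N) ⟩
      ℚ.∣ seq x n ℚ.- seq x N ∣ ℚ.+ ℚ.∣ seq x N ∣
        ≤⟨ ℚ.+-monoˡ-≤ ℚ.∣ seq x N ∣ (h n N n≥ ℕ.≤-refl) ⟩
      1ℚ ℚ.+ ℚ.∣ seq x N ∣ ∎
    where
    open ℚ.≤-Reasoning
    open +-*-Solver

  const-≉ : ∀ {p} → 0ℚ ℚ.< p → ¬ Null (λ _ → p)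
  const-≉ {p} 0<p p0 with N , h ← p0 (p ℚ.* ½) (half>0 0<p) = ℚ.<-irrefl refl (ℚ.<-≤-trans
    (begin-strict
      p ℚ.* ½                    ≡⟨ ℚ.+-identityʳ (p ℚ.* ½) ⟨
      p ℚ.* ½ ℚ.+ 0ℚ             <⟨ ℚ.+-monoʳ-< (p ℚ.* ½) (half>0 0<p) ⟩
      p ℚ.* ½ ℚ.+ p ℚ.* ½        ≡⟨ 2halves p ⟩
      p                          ≡⟨ ℚ.0≤p⇒∣p∣≡p (ℚ.<⇒≤ 0<p) ⟨
      ℚ.∣ p ∣                    ∎)
    (h N ℕ.≤-refl))
    where open ℚ.≤-Reasoning

-- Arithmetic of ≈ℝ

abstract
  ≗⇒≈ : ∀ {x y} → (∀ n → seq x n ≡ seq y n) → x ≈ℝ y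
  ≗⇒≈ {x} {y} x≗y = null-≗
    (λ n → sym (trans (cong (ℚ._- seq y n) (x≗y n)) (ℚ.+-inverseʳ (seq y n)))) null-0

  ≈-sym : ∀ {x y} → x ≈ℝ y → y ≈ℝ x
  ≈-sym {x} {y} x≈y = null-≗ (λ n → solve 2 (λ a b → :- (a :- b) := b :- a) refl (seq x n) (seq y n))
    (null-neg x≈y)
    where open +-*-Solver

  ≈-trans : ∀ {x y z} → x ≈ℝ y → y ≈ℝ z → x ≈ℝ z
  ≈-trans {x} {y} {z} x≈y y≈z = null-≗
    (λ n → solve 3 (λ a b c → (a :- b) :+ (b :- c) := a :- c) refl (seq x n) (seq y n) (seq z n))
    (null-+ x≈y y≈z)
    where open +-*-Solver

  +-cong : ∀ {x x′ y y′} → x ≈ℝ x′ → y ≈ℝ y′ → x +ℝ y ≈ℝ x′ +ℝ y′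
  +-cong {x} {x′} {y} {y′} x≈ y≈ = null-≗
    (λ n → solve 4 (λ a a′ b b′ → (a :- a′) :+ (b :- b′) := (a :+ b) :- (a′ :+ b′)) refl
      (seq x n) (seq x′ n) (seq y n) (seq y′ n))
    (null-+ x≈ y≈)
    where open +-*-Solver

  neg-cong : ∀ {x x′} → x ≈ℝ x′ → -ℝ x ≈ℝ -ℝ x′
  neg-cong {x} {x′} x≈ = null-≗
    (λ n → solve 2 (λ a a′ → :- (a :- a′) := (:- a) :- (:- a′)) refl (seq x n) (seq x′ n))
    (null-neg x≈)
    where open +-*-Solver

  *-cong : ∀ {x x′ y y′} → x ≈ℝ x′ → y ≈ℝ y′ → x *ℝ y ≈ℝ x′ *ℝ y′
  *-cong {x} {x′} {y} {y′} x≈ y≈ = null-≗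
    (λ n → solve 4 (λ a a′ b b′ → (a :- a′) :* b :+ (b :- b′) :* a′ := a :* b :- a′ :* b′) refl
      (seq x n) (seq x′ n) (seq y n) (seq y′ n))
    (null-+ (null-*-bounded x≈ (cauchy-bounded y)) (null-*-bounded y≈ (cauchy-bounded x′)))
    where open +-*-Solver

  ∑-cong : ∀ {A : Set} (xs : List A) {f g : A → ℝ} → (∀ x → f x ≈ℝ g x) → ∑ xs f ≈ℝ ∑ xs g
  ∑-cong []       _   = null-0
  ∑-cong (x ∷ xs) {f} {g} f≈g =
    +-cong {f x} {g x} {∑ xs f} {∑ xs g} (f≈g x) (∑-cong xs f≈g)

  ≈0⇒null : ∀ {x} → x ≈ℝ 0ℝ → Null (seq x)
  ≈0⇒null {x} = null-≗ λ n → ℚ.+-identityʳ (seq x n)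

  null⇒≈0 : ∀ {x} → Null (seq x) → x ≈ℝ 0ℝ
  null⇒≈0 {x} = null-≗ λ n → sym (ℚ.+-identityʳ (seq x n))

-- Constructively, x ≤ q can be decided up to an arbitrarily small error.
abstract
  compare : ∀ x q ε → 0ℚ ℚ.< ε →
    (∃[ N ] ∀ n → N ℕ.≤ n → seq x n ℚ.≤ q ℚ.+ ε) ⊎
    (∃[ η ] 0ℚ ℚ.< η × ∃[ N ] ∀ n → N ℕ.≤ n → q ℚ.+ η ℚ.≤ seq x n)
  -- From `N` on the sequence varies by at most ε/4, so one rational comparison of its `N`-th term
  -- with q + ε/2 settles the tail: it stays below q + ε or above q + ε/4.
  compare x q ε 0<ε with N , h ← cauchy x (ε ℚ.* ½ ℚ.* ½) (half>0 (half>0 0<ε))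
    with seq x N ℚ.≤? q ℚ.+ ε ℚ.* ½
  ... | yes x≤ = inj₁ (N , λ n n≥ → begin
        seq x n                                    ≡⟨ split (seq x n) (seq x N) ⟩
        seq x N ℚ.+ (seq x n ℚ.- seq x N)          ≤⟨ ℚ.+-mono-≤ x≤ (ℚ.≤-trans (p≤∣p∣ _) (h n N n≥ ℕ.≤-refl)) ⟩
        (q ℚ.+ ε ℚ.* ½) ℚ.+ ε ℚ.* ½ ℚ.* ½          ≤⟨ ℚ.+-monoʳ-≤ (q ℚ.+ ε ℚ.* ½) (half≤ (half>0 0<ε)) ⟩
        (q ℚ.+ ε ℚ.* ½) ℚ.+ ε ℚ.* ½                ≡⟨ ℚ.+-assoc q (ε ℚ.* ½) (ε ℚ.* ½) ⟩
        q ℚ.+ (ε ℚ.* ½ ℚ.+ ε ℚ.* ½)                ≡⟨ cong (q ℚ.+_) (2halves ε) ⟩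
        q ℚ.+ ε                                    ∎)
    where
    open ℚ.≤-Reasoning
    open +-*-Solver
    split : ∀ a b → a ≡ b ℚ.+ (a ℚ.- b)
    split = solve 2 (λ a b → a := b :+ (a :- b)) refl
  ... | no  x≰ = inj₂ (ε ℚ.* ½ ℚ.* ½ , half>0 (half>0 0<ε) , N , λ n n≥ → begin
        q ℚ.+ ε ℚ.* ½ ℚ.* ½
          ≡⟨ split q (ε ℚ.* ½ ℚ.* ½) ⟩
        (q ℚ.+ (ε ℚ.* ½ ℚ.* ½ ℚ.+ ε ℚ.* ½ ℚ.* ½)) ℚ.- ε ℚ.* ½ ℚ.* ½
          ≡⟨ cong (λ e → (q ℚ.+ e) ℚ.- ε ℚ.* ½ ℚ.* ½) (2halves (ε ℚ.* ½)) ⟩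
        (q ℚ.+ ε ℚ.* ½) ℚ.- ε ℚ.* ½ ℚ.* ½
          ≤⟨ ℚ.+-mono-≤ (ℚ.<⇒≤ (ℚ.≰⇒> x≰)) (ℚ.neg-antimono-≤
               (ℚ.≤-trans (p≤∣p∣ _) (h N n ℕ.≤-refl n≥))) ⟩
        seq x N ℚ.- (seq x N ℚ.- seq x n)
          ≡⟨ cancel (seq x N) (seq x n) ⟩
        seq x n ∎)
    where
    open ℚ.≤-Reasoning
    open +-*-Solver
    split : ∀ a b → a ℚ.+ b ≡ (a ℚ.+ (b ℚ.+ b)) ℚ.- b
    split = solve 2 (λ a b → a :+ b := (a :+ (b :+ b)) :- b) refl
    cancel : ∀ a b → a ℚ.- (a ℚ.- b) ≡ b
    cancel = solve 2 (λ a b → a :- (a :- b) := b) refl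

  -- The second outcome of `compare` places `x` above `q` by a definite margin and so refutes the
  -- inequality; only the first outcome is left, for every `ε`.
  ≤ℚ-stable : ∀ x q → ¬ ¬ (x ≤ℝ fromℚ q) → x ≤ℝ fromℚ q
  ≤ℚ-stable x q ¬¬x≤q ε 0<ε with compare x q ε 0<ε
  ... | inj₁ x≤ = x≤
  ... | inj₂ (η , 0<η , M , x≥) = ⊥-elim (¬¬x≤q λ x≤q →
    let N , h = x≤q (η ℚ.* ½) (half>0 0<η) in
    ℚ.<-irrefl refl (begin-strict
      q ℚ.+ η                      ≤⟨ x≥ (M ℕ.⊔ N) (ℕ.m≤m⊔n M N) ⟩
      seq x (M ℕ.⊔ N)              ≤⟨ h (M ℕ.⊔ N) (ℕ.m≤n⊔m M N) ⟩
      q ℚ.+ η ℚ.* ½                ≡⟨ ℚ.+-identityʳ _ ⟨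
      q ℚ.+ η ℚ.* ½ ℚ.+ 0ℚ         <⟨ ℚ.+-monoʳ-< (q ℚ.+ η ℚ.* ½) (half>0 0<η) ⟩
      q ℚ.+ η ℚ.* ½ ℚ.+ η ℚ.* ½    ≡⟨ ℚ.+-assoc q _ _ ⟩
      q ℚ.+ (η ℚ.* ½ ℚ.+ η ℚ.* ½)  ≡⟨ cong (q ℚ.+_) (2halves η) ⟩
      q ℚ.+ η                      ∎))
    where open ℚ.≤-Reasoning

  -- If r exceeded q, then η N ≤ r N − E would force N to be null.
  quotient≤ : ∀ r N E q → (∀ n → 0ℚ ℚ.≤ seq N n) → (∀ n → seq E n ℚ.≤ q ℚ.* seq N n) →
    r *ℝ N ≈ℝ E → ¬ Null (seq N) → r ≤ℝ fromℚ q
  quotient≤ r N E q 0≤N E≤qN rN≈E N≉0 ε 0<ε with compare r q ε 0<ε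
  ... | inj₁ r≤ = r≤
  ... | inj₂ (η , 0<η , M , r≥) with η⁻¹ , 0<η⁻¹ , eq ← reciprocal 0<η = contradiction
    (null-≗ (λ n → undo n) (null-*-bounded
      (null-squeeze {λ n → η ℚ.* seq N n}
        (M , λ n n≥ → *≥0 (ℚ.<⇒≤ 0<η) (0≤N n) , (begin
          η ℚ.* seq N n
            ≡⟨ expand q η (seq N n) ⟩
          (q ℚ.+ η) ℚ.* seq N n ℚ.- q ℚ.* seq N n
            ≤⟨ ℚ.+-mono-≤ (*-mono-≤ʳ (0≤N n) (r≥ n n≥)) (ℚ.neg-antimono-≤ (E≤qN n)) ⟩
          seq r n ℚ.* seq N n ℚ.- seq E n ∎))
        rN≈E)
      (0 , η⁻¹ , 0<η⁻¹ , λ _ _ → ℚ.≤-reflexive (ℚ.0≤p⇒∣p∣≡p (ℚ.<⇒≤ 0<η⁻¹)))))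
    N≉0
    where
    open ℚ.≤-Reasoning
    open +-*-Solver
    expand : ∀ a b c → b ℚ.* c ≡ (a ℚ.+ b) ℚ.* c ℚ.- a ℚ.* c
    expand = solve 3 (λ a b c → b :* c := (a :+ b) :* c :- a :* c) refl
    undo : ∀ n → η ℚ.* seq N n ℚ.* η⁻¹ ≡ seq N n
    undo n = trans (solve 3 (λ a b c → a :* b :* c := (c :* a) :* b) refl η (seq N n) η⁻¹)
      (trans (cong (ℚ._* seq N n) eq) (ℚ.*-identityˡ (seq N n)))

-- The plane spanned by 1 and a rational function

sumℚ : {A : Set} → List A → (A → ℚ) → ℚ
sumℚ xs f = foldr (λ x acc → f x ℚ.+ acc) 0ℚ xs

abstract
  seq-∑ : ∀ {A : Set} (xs : List A) (f : A → ℝ) k → seq (∑ xs f) k ≡ sumℚ xs (λ x → seq (f x) k)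
  seq-∑ []       f k = refl
  seq-∑ (x ∷ xs) f k = cong (seq (f x) k ℚ.+_) (seq-∑ xs f k)

  sumℚ-square : ∀ {A : Set} (xs : List A) (g : A → ℚ) c d →
    sumℚ xs (λ x → (c ℚ.+ d ℚ.* g x) ℚ.* (c ℚ.+ d ℚ.* g x)) ≡
    c ℚ.* c ℚ.* sumℚ xs (λ _ → 1ℚ) ℚ.+ (c ℚ.* d ℚ.+ c ℚ.* d) ℚ.* sumℚ xs g ℚ.+
      d ℚ.* d ℚ.* sumℚ xs (λ x → g x ℚ.* g x)
  sumℚ-square [] g c d = base c d
    where
    open +-*-Solver
    base : ∀ c d → 0ℚ ≡ c ℚ.* c ℚ.* 0ℚ ℚ.+ (c ℚ.* d ℚ.+ c ℚ.* d) ℚ.* 0ℚ ℚ.+ d ℚ.* d ℚ.* 0ℚ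
    base = solve 2 (λ c d → con 0ℚ := c :* c :* con 0ℚ :+ (c :* d :+ c :* d) :* con 0ℚ :+ d :* d :* con 0ℚ) refl
  sumℚ-square (x ∷ xs) g c d = trans (cong ((c ℚ.+ d ℚ.* g x) ℚ.* (c ℚ.+ d ℚ.* g x) ℚ.+_) (sumℚ-square xs g c d))
    (step c d (g x) (sumℚ xs (λ _ → 1ℚ)) (sumℚ xs g) (sumℚ xs (λ x → g x ℚ.* g x)))
    where
    open +-*-Solver
    step : ∀ c d y s₀ s₁ s₂ →
      (c ℚ.+ d ℚ.* y) ℚ.* (c ℚ.+ d ℚ.* y) ℚ.+
        (c ℚ.* c ℚ.* s₀ ℚ.+ (c ℚ.* d ℚ.+ c ℚ.* d) ℚ.* s₁ ℚ.+ d ℚ.* d ℚ.* s₂) ≡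
      c ℚ.* c ℚ.* (1ℚ ℚ.+ s₀) ℚ.+ (c ℚ.* d ℚ.+ c ℚ.* d) ℚ.* (y ℚ.+ s₁) ℚ.+ d ℚ.* d ℚ.* (y ℚ.* y ℚ.+ s₂)
    step = solve 6 (λ c d y s₀ s₁ s₂ →
      (c :+ d :* y) :* (c :+ d :* y) :+ (c :* c :* s₀ :+ (c :* d :+ c :* d) :* s₁ :+ d :* d :* s₂) :=
      c :* c :* (con 1ℚ :+ s₀) :+ (c :* d :+ c :* d) :* (y :+ s₁) :+ d :* d :* (y :* y :+ s₂)) refl

  sumℚ-scale : ∀ {A : Set} (xs : List A) (f : A → ℚ) c → sumℚ xs (λ x → c ℚ.* f x) ≡ c ℚ.* sumℚ xs f
  sumℚ-scale []       f c = sym (ℚ.*-zeroʳ c)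
  sumℚ-scale (x ∷ xs) f c = trans (cong (c ℚ.* f x ℚ.+_) (sumℚ-scale xs f c))
    (sym (ℚ.*-distribˡ-+ c (f x) (sumℚ xs f)))

  sumℚ-cong : ∀ {A : Set} (xs : List A) {f g : A → ℚ} → (∀ x → f x ≡ g x) → sumℚ xs f ≡ sumℚ xs g
  sumℚ-cong []       f≗g = refl
  sumℚ-cong (x ∷ xs) f≗g = cong₂ ℚ._+_ (f≗g x) (sumℚ-cong xs f≗g)

  sumℚ-≥0 : ∀ {A : Set} (xs : List A) {f : A → ℚ} → (∀ x → 0ℚ ℚ.≤ f x) → 0ℚ ℚ.≤ sumℚ xs f
  sumℚ-≥0 []       0≤f = ℚ.≤-refl
  sumℚ-≥0 (x ∷ xs) 0≤f = ℚ.+-mono-≤ (0≤f x) (sumℚ-≥0 xs 0≤f)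

  ∑-filter-null : ∀ {A : Set} {P : Pred A 0ℓ} (P? : ∀ x → Dec (P x)) xs {f : A → ℝ} →
    (∀ x → P x → f x ≈ℝ 0ℝ) → ∑ (filter P? xs) f ≈ℝ 0ℝ
  ∑-filter-null P? []       f≈0 = null-0
  ∑-filter-null P? (x ∷ xs) {f} f≈0 with P? x
  ... | no  _  = ∑-filter-null P? xs f≈0
  ... | yes Px = null-≗ (λ n → cong (λ q → (seq (f x) n ℚ.+ seq (∑ (filter P? xs) f) n) ℚ.- q) (ℚ.+-identityˡ 0ℚ))
    (+-cong {f x} {0ℝ} {∑ (filter P? xs) f} {0ℝ} (f≈0 x Px) (∑-filter-null P? xs f≈0))

module _ {n : ℕ} (G : Graph n) (δΩ : Subset n) where
  open Graph G

  boundary : List (Fin n)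
  boundary = filter (_∈? δΩ) (allFin n)

  boundarySize : ℚ
  boundarySize = sumℚ boundary (λ _ → 1ℚ)

  rationalNorm² rationalEnergy : (Fin n → ℚ) → ℚ
  rationalNorm²  g = sumℚ boundary (λ x → g x ℚ.* g x)
  rationalEnergy g = sumℚ edges (λ (x , y) → (g x ℚ.- g y) ℚ.* (g x ℚ.- g y))

  abstract
    energy-cong : ∀ {f h} → f ≈ᵥ h → energy G δΩ f ≈ℝ energy G δΩ h
    energy-cong {f} {h} f≈h = ∑-cong edges λ (x , y) →
      let d≈ = +-cong {f x} {h x} { -ℝ f y} { -ℝ h y} (f≈h x) (neg-cong {f y} {h y} (f≈h y)) in
      *-cong {f x -ℝ f y} {h x -ℝ h y} {f x -ℝ f y} {h x -ℝ h y} d≈ d≈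

    boundaryNorm²-cong : ∀ {f h} → f ≈ᵥ h → boundaryNorm² G δΩ f ≈ℝ boundaryNorm² G δΩ h
    boundaryNorm²-cong {f} {h} f≈h = ∑-cong boundary λ x →
      *-cong {f x} {h x} {f x} {h x} (f≈h x) (f≈h x)

    vanishing⇒norm-null : ∀ {f} → VanishesOnBoundary G δΩ f → Null (seq (boundaryNorm² G δΩ f))
    vanishing⇒norm-null {f} f≈0 = ≈0⇒null {boundaryNorm² G δΩ f}
      (∑-filter-null (_∈? δΩ) (allFin n) λ x x∈ →
        ≈-trans {f x ²} {0ℝ *ℝ 0ℝ} {0ℝ} (*-cong {f x} {0ℝ} {f x} {0ℝ} (f≈0 x x∈) (f≈0 x x∈)) (≗⇒≈ {0ℝ *ℝ 0ℝ} {0ℝ} λ _ → ℚ.*-zeroˡ 0ℚ))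

  -- A rational function g with zero boundary mean is orthogonal to the constants for both the
  -- energy and the boundary norm, so the maximum of the Rayleigh quotient over the span of 1
  -- and g is attained at g.
  module _ (g : Fin n → ℚ) (1≤L : 1ℚ ℚ.≤ boundarySize) (1≤N : 1ℚ ℚ.≤ rationalNorm² g)
           (mean≡0 : sumℚ boundary g ≡ 0ℚ)
           (q : ℚ) (qN≡E : q ℚ.* rationalNorm² g ≡ rationalEnergy g) where

    private
      L N E : ℚ
      L = boundarySize
      N = rationalNorm² g
      E = rationalEnergy g

    basis : Vector (Vector ℝ n) 2
    basis zero    x = fromℚ 1ℚ
    basis (suc _) x = fromℚ (g x)

    combination : Vector ℝ 2 → Vector ℝ n
    combination c = linearCombination c basis

    Plane : Pred (Vector ℝ n) 0ℓ
    Plane f = ∃[ c ] f ≈ᵥ combination c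

    private
      c₀ c₁ : Vector ℝ 2 → ℕ → ℚ
      c₀ c k = seq (c zero) k
      c₁ c k = seq (c (suc zero)) k

    abstract
      seq-combination : ∀ c x k → seq (combination c x) k ≡ c₀ c k ℚ.+ c₁ c k ℚ.* g x
      seq-combination c x k = cong₂ ℚ._+_ (ℚ.*-identityʳ (c₀ c k)) (ℚ.+-identityʳ (c₁ c k ℚ.* g x))

      seq-norm : ∀ c k → seq (boundaryNorm² G δΩ (combination c)) k ≡
        c₀ c k ℚ.* c₀ c k ℚ.* L ℚ.+ c₁ c k ℚ.* c₁ c k ℚ.* N
      seq-norm c k = begin
        seq (boundaryNorm² G δΩ (combination c)) k
          ≡⟨ seq-∑ boundary (λ x → combination c x ²) k ⟩
        sumℚ boundary (λ x → seq (combination c x) k ℚ.* seq (combination c x) k)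
          ≡⟨ sumℚ-cong boundary (λ x → cong₂ ℚ._*_ (seq-combination c x k) (seq-combination c x k)) ⟩
        sumℚ boundary (λ x → (a ℚ.+ b ℚ.* g x) ℚ.* (a ℚ.+ b ℚ.* g x))
          ≡⟨ sumℚ-square boundary g a b ⟩
        a ℚ.* a ℚ.* L ℚ.+ (a ℚ.* b ℚ.+ a ℚ.* b) ℚ.* sumℚ boundary g ℚ.+ b ℚ.* b ℚ.* N
          ≡⟨ cong (λ m → a ℚ.* a ℚ.* L ℚ.+ (a ℚ.* b ℚ.+ a ℚ.* b) ℚ.* m ℚ.+ b ℚ.* b ℚ.* N) mean≡0 ⟩
        a ℚ.* a ℚ.* L ℚ.+ (a ℚ.* b ℚ.+ a ℚ.* b) ℚ.* 0ℚ ℚ.+ b ℚ.* b ℚ.* N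
          ≡⟨ drop-middle (a ℚ.* a ℚ.* L) (a ℚ.* b ℚ.+ a ℚ.* b) (b ℚ.* b ℚ.* N) ⟩
        a ℚ.* a ℚ.* L ℚ.+ b ℚ.* b ℚ.* N ∎
        where
        open ≡-Reasoning
        open +-*-Solver
        a b : ℚ
        a = c₀ c k
        b = c₁ c k
        drop-middle : ∀ a b c → a ℚ.+ b ℚ.* 0ℚ ℚ.+ c ≡ a ℚ.+ c
        drop-middle = solve 3 (λ a b c → a :+ b :* con 0ℚ :+ c := a :+ c) refl

      seq-energy : ∀ c k → seq (energy G δΩ (combination c)) k ≡ c₁ c k ℚ.* c₁ c k ℚ.* E
      seq-energy c k = trans (seq-∑ edges (λ (x , y) → (combination c x -ℝ combination c y) ²) k)
        (trans (sumℚ-cong edges λ (x , y) → trans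
          (cong₂ (λ a b → (a ℚ.- b) ℚ.* (a ℚ.- b)) (seq-combination c x k) (seq-combination c y k))
          (difference (c₀ c k) (c₁ c k) (g x) (g y)))
          (sumℚ-scale edges (λ (x , y) → (g x ℚ.- g y) ℚ.* (g x ℚ.- g y)) (c₁ c k ℚ.* c₁ c k)))
        where
        open +-*-Solver
        difference : ∀ c d a b →
          ((c ℚ.+ d ℚ.* a) ℚ.- (c ℚ.+ d ℚ.* b)) ℚ.* ((c ℚ.+ d ℚ.* a) ℚ.- (c ℚ.+ d ℚ.* b)) ≡
          d ℚ.* d ℚ.* ((a ℚ.- b) ℚ.* (a ℚ.- b))
        difference = solve 4 (λ c d a b →
          ((c :+ d :* a) :- (c :+ d :* b)) :* ((c :+ d :* a) :- (c :+ d :* b)) :=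
          d :* d :* ((a :- b) :* (a :- b))) refl

      private
        part : ∀ p {M} → 1ℚ ℚ.≤ M → p ℚ.* p ℚ.≤ p ℚ.* p ℚ.* M
        part p {M} 1≤M = subst (ℚ._≤ p ℚ.* p ℚ.* M) (ℚ.*-identityʳ (p ℚ.* p)) (*-mono-≤ˡ (square≥0 p) 1≤M)

        part≥0 : ∀ p {M} → 1ℚ ℚ.≤ M → 0ℚ ℚ.≤ p ℚ.* p ℚ.* M
        part≥0 p 1≤M = ℚ.≤-trans (square≥0 p) (part p 1≤M)

      c₀²≤norm : ∀ c k → c₀ c k ℚ.* c₀ c k ℚ.≤ seq (boundaryNorm² G δΩ (combination c)) k
      c₀²≤norm c k = subst₂ ℚ._≤_ (ℚ.+-identityʳ (c₀ c k ℚ.* c₀ c k)) (sym (seq-norm c k))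
        (ℚ.+-mono-≤ (part (c₀ c k) 1≤L) (part≥0 (c₁ c k) 1≤N))

      c₁²N≤norm : ∀ c k → c₁ c k ℚ.* c₁ c k ℚ.* N ℚ.≤ seq (boundaryNorm² G δΩ (combination c)) k
      c₁²N≤norm c k = subst₂ ℚ._≤_ (ℚ.+-identityˡ (c₁ c k ℚ.* c₁ c k ℚ.* N)) (sym (seq-norm c k))
        (ℚ.+-mono-≤ (part≥0 (c₀ c k) 1≤L) ℚ.≤-refl)

      c₁²≤norm : ∀ c k → c₁ c k ℚ.* c₁ c k ℚ.≤ seq (boundaryNorm² G δΩ (combination c)) k
      c₁²≤norm c k = ℚ.≤-trans (part (c₁ c k) 1≤N) (c₁²N≤norm c k)

      norm≥0 : ∀ c k → 0ℚ ℚ.≤ seq (boundaryNorm² G δΩ (combination c)) k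
      norm≥0 c k = ℚ.≤-trans (square≥0 (c₀ c k)) (c₀²≤norm c k)

      q≥0 : 0ℚ ℚ.≤ q
      q≥0 = ℚ.*-cancelʳ-≤-pos N {{ℚ.positive (ℚ.<-≤-trans (ℚ.positive⁻¹ 1ℚ) 1≤N)}}
        (subst₂ ℚ._≤_ (sym (ℚ.*-zeroˡ N)) (sym qN≡E)
          (sumℚ-≥0 edges λ (x , y) → square≥0 (g x ℚ.- g y)))

      energy≤q*norm : ∀ c k →
        seq (energy G δΩ (combination c)) k ℚ.≤ q ℚ.* seq (boundaryNorm² G δΩ (combination c)) k
      energy≤q*norm c k = begin
        seq (energy G δΩ (combination c)) k                 ≡⟨ seq-energy c k ⟩
        c₁ c k ℚ.* c₁ c k ℚ.* E                             ≡⟨ cong (c₁ c k ℚ.* c₁ c k ℚ.*_) qN≡E ⟨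
        c₁ c k ℚ.* c₁ c k ℚ.* (q ℚ.* N)                     ≡⟨ swap (c₁ c k) q N ⟩
        q ℚ.* (c₁ c k ℚ.* c₁ c k ℚ.* N)                     ≤⟨ *-mono-≤ˡ q≥0 (c₁²N≤norm c k) ⟩
        q ℚ.* seq (boundaryNorm² G δΩ (combination c)) k    ∎
        where
        open ℚ.≤-Reasoning
        open +-*-Solver
        swap : ∀ d a b → d ℚ.* d ℚ.* (a ℚ.* b) ≡ a ℚ.* (d ℚ.* d ℚ.* b)
        swap = solve 3 (λ d a b → d :* d :* (a :* b) := a :* (d :* d :* b)) refl

      -- As `1 ≤ L` and `1 ≤ N`, the norm dominates both squared coefficients. This yields the
      -- independence of the basis and excludes the value +∞ on nonzero functions of the plane.
      norm-null⇒coefficients≈0 : ∀ c → Null (seq (boundaryNorm² G δΩ (combination c))) → c ≈ᵥ 0ᵥ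
      norm-null⇒coefficients≈0 c N0 zero       = null⇒≈0 {c zero} (null-sqrt (c₀²≤norm c) N0)
      norm-null⇒coefficients≈0 c N0 (suc zero) = null⇒≈0 {c (suc zero)} (null-sqrt (c₁²≤norm c) N0)

      coefficients≈0⇒combination≈0 : ∀ c → c ≈ᵥ 0ᵥ → combination c ≈ᵥ 0ᵥ
      coefficients≈0⇒combination≈0 c c≈0 x = null⇒≈0 {combination c x} (null-≗
        (λ k → sym (seq-combination c x k))
        (null-+ (≈0⇒null {c zero} (c≈0 zero))
          (null-*-bounded (≈0⇒null {c (suc zero)} (c≈0 (suc zero))) (cauchy-bounded (fromℚ (g x))))))

      norm-cong-null : ∀ {f h} → f ≈ᵥ h →
        Null (seq (boundaryNorm² G δΩ f)) → Null (seq (boundaryNorm² G δΩ h))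
      norm-cong-null {f} {h} f≈h N0 = ≈0⇒null {boundaryNorm² G δΩ h}
        (≈-trans {boundaryNorm² G δΩ h} {boundaryNorm² G δΩ f} {0ℝ}
          (≈-sym {boundaryNorm² G δΩ f} {boundaryNorm² G δΩ h} (boundaryNorm²-cong f≈h))
          (null⇒≈0 {boundaryNorm² G δΩ f} N0))

      norm-null⇒≈0 : ∀ {f} → Plane f → Null (seq (boundaryNorm² G δΩ f)) → f ≈ᵥ 0ᵥ
      norm-null⇒≈0 {f} (c , f≈c) N0 x = ≈-trans {f x} {combination c x} {0ℝ} (f≈c x)
        (coefficients≈0⇒combination≈0 c
          (norm-null⇒coefficients≈0 c (norm-cong-null {f} {combination c} f≈c N0)) x)

      plane-isSubspace : IsSubspace Plane
      plane-isSubspace = record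
        { resp-≈ = λ {f} {h} f≈h (c , f≈c) → c , λ x →
            ≈-trans {h x} {f x} {combination c x} (≈-sym {f x} {h x} (f≈h x)) (f≈c x)
        ; 0∈     = 0ᵥ , λ x → ≗⇒≈ {0ℝ} {combination 0ᵥ x} λ k →
            sym (trans (seq-combination 0ᵥ x k) (trans (ℚ.+-identityˡ (0ℚ ℚ.* g x)) (ℚ.*-zeroˡ (g x))))
        ; +-clos = λ {f} {h} (c , f≈c) (d , h≈d) →
            let c+d = λ i → c i +ℝ d i in c+d , λ x →
            ≈-trans {f x +ℝ h x} {combination c x +ℝ combination d x} {combination c+d x}
              (+-cong {f x} {combination c x} {h x} {combination d x} (f≈c x) (h≈d x))
              (≗⇒≈ {combination c x +ℝ combination d x} {combination c+d x} λ k → trans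
                (cong₂ ℚ._+_ (seq-combination c x k) (seq-combination d x k))
                (trans (add (c₀ c k) (c₁ c k) (c₀ d k) (c₁ d k) (g x)) (sym (seq-combination c+d x k))))
        ; ·-clos = λ a {f} (c , f≈c) →
            let ac = λ i → a *ℝ c i in ac , λ x →
            ≈-trans {a *ℝ f x} {a *ℝ combination c x} {combination ac x}
              (*-cong {a} {a} {f x} {combination c x} (≗⇒≈ {a} {a} λ _ → refl) (f≈c x))
              (≗⇒≈ {a *ℝ combination c x} {combination ac x} λ k → trans
                (cong (seq a k ℚ.*_) (seq-combination c x k))
                (trans (scale (seq a k) (c₀ c k) (c₁ c k) (g x)) (sym (seq-combination ac x k))))
        }
        where
        open +-*-Solver
        add : ∀ c d c′ d′ y → (c ℚ.+ d ℚ.* y) ℚ.+ (c′ ℚ.+ d′ ℚ.* y) ≡ (c ℚ.+ c′) ℚ.+ (d ℚ.+ d′) ℚ.* y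
        add = solve 5 (λ c d c′ d′ y → (c :+ d :* y) :+ (c′ :+ d′ :* y) := (c :+ c′) :+ (d :+ d′) :* y) refl
        scale : ∀ a c d y → a ℚ.* (c ℚ.+ d ℚ.* y) ≡ a ℚ.* c ℚ.+ a ℚ.* d ℚ.* y
        scale = solve 4 (λ a c d y → a :* (c :+ d :* y) := a :* c :+ a :* d :* y) refl

      unit : Fin 2 → Vector ℝ 2
      unit zero       zero       = fromℚ 1ℚ
      unit zero       (suc zero) = 0ℝ
      unit (suc zero) zero       = 0ℝ
      unit (suc zero) (suc zero) = fromℚ 1ℚ

      basis-unit : ∀ i → basis i ≈ᵥ combination (unit i)
      basis-unit zero       x = ≗⇒≈ {fromℚ 1ℚ} {combination (unit zero) x} λ k →
        sym (trans (seq-combination (unit zero) x k) (trans (cong (1ℚ ℚ.+_) (ℚ.*-zeroˡ (g x))) (ℚ.+-identityʳ 1ℚ)))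
      basis-unit (suc zero) x = ≗⇒≈ {fromℚ (g x)} {combination (unit (suc zero)) x} λ k →
        sym (trans (seq-combination (unit (suc zero)) x k) (trans (ℚ.+-identityˡ (1ℚ ℚ.* g x)) (ℚ.*-identityˡ (g x))))

      vanishing⇒≈0 : ∀ {f} → Plane f → VanishesOnBoundary G δΩ f → f ≈ᵥ 0ᵥ
      vanishing⇒≈0 {f} f∈ vanishes = norm-null⇒≈0 {f} f∈ (vanishing⇒norm-null {f} vanishes)

      plane-isBasis : IsBasis Plane basis
      plane-isBasis = record
        { inside      = λ i → unit i , basis-unit i
        ; independent = λ c h≈0 → norm-null⇒coefficients≈0 c (vanishing⇒norm-null {combination c} λ x _ → h≈0 x)
        ; spanning    = id
        }

      g≉0 : ¬ (basis (suc zero) ≈ᵥ 0ᵥ)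
      g≉0 g≈0 = const-≉ {1ℚ} (ℚ.positive⁻¹ 1ℚ) (≈0⇒null {fromℚ 1ℚ} (unit≈0 (suc zero)))
        where
        unit≈0 : unit (suc zero) ≈ᵥ 0ᵥ
        unit≈0 = norm-null⇒coefficients≈0 (unit (suc zero))
          (norm-cong-null {basis (suc zero)} {combination (unit (suc zero))} (basis-unit (suc zero))
            (vanishing⇒norm-null {basis (suc zero)} λ x _ → g≈0 x))

      plane-max : IsMaxRayleighQuotient G δΩ Plane [ fromℚ q ]
      plane-max =
        (basis (suc zero) , (unit (suc zero) , basis-unit (suc zero)) , g≉0 ,
          finite (λ vanishes → g≉0 (vanishing⇒≈0 {basis (suc zero)} (unit (suc zero) , basis-unit (suc zero)) vanishes))
            (≗⇒≈ {fromℚ q *ℝ boundaryNorm² G δΩ (basis (suc zero))} {energy G δΩ (basis (suc zero))} λ k →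
              trans (cong (q ℚ.*_) (seq-∑ boundary (λ x → basis (suc zero) x ²) k))
              (trans qN≡E (sym (seq-∑ edges (λ (x , y) → (basis (suc zero) x -ℝ basis (suc zero) y) ²) k))))) ,
        λ
        { (f , f∈ , f≉0 , infinite vanishes) → contradiction (vanishing⇒≈0 {f} f∈ vanishes) f≉0
        -- The bounds on norm and energy hold term by term only for `combination c`, so the quotient
        -- equation of `f` is transported there.
        ; (f , (c , f≈c) , f≉0 , finite {r} _ rN≈E) → [ quotient≤ r
            (boundaryNorm² G δΩ (combination c)) (energy G δΩ (combination c)) q
            (norm≥0 c) (energy≤q*norm c)
            (≈-trans {r *ℝ boundaryNorm² G δΩ (combination c)} {r *ℝ boundaryNorm² G δΩ f} {energy G δΩ (combination c)}
              (*-cong {r} {r} {boundaryNorm² G δΩ (combination c)} {boundaryNorm² G δΩ f}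
                (≗⇒≈ {r} {r} λ _ → refl)
                (≈-sym {boundaryNorm² G δΩ f} {boundaryNorm² G δΩ (combination c)} (boundaryNorm²-cong {f} {combination c} f≈c)))
              (≈-trans {r *ℝ boundaryNorm² G δΩ f} {energy G δΩ f} {energy G δΩ (combination c)}
                rN≈E (energy-cong {f} {combination c} f≈c)))
            (λ N0 → f≉0 (λ x → ≈-trans {f x} {combination c x} {0ℝ} (f≈c x)
              (coefficients≈0⇒combination≈0 c (norm-null⇒coefficients≈0 c N0) x))) ]
        }

    λ₂≤quotient : ∀ {λ₂} → IsSteklovEigenvalue G δΩ 2 λ₂ → λ₂ ≤∞ [ fromℚ q ]
    λ₂≤quotient (_ , least) = least (Plane , plane-isSubspace , (basis , plane-isBasis) , plane-max)

-- Natural numbers as rationals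

ι : ℕ → ℚ
ι n = + n / 1

abstract
  -- A quotient `i / n` is `fromℚᵘ` of an unreduced fraction. Once `fromℚᵘ` respects the operations,
  -- identities between such quotients become cross-multiplications of integers, free of greatest
  -- common divisors.
  fromℚᵘ-homo-+ : ∀ p q → fromℚᵘ (p ℚᵘ.+ q) ≡ fromℚᵘ p ℚ.+ fromℚᵘ q
  fromℚᵘ-homo-+ p q = ℚ.toℚᵘ-injective (ℚᵘ.≃-trans (ℚ.toℚᵘ-fromℚᵘ (p ℚᵘ.+ q)) (ℚᵘ.≃-sym
    (ℚᵘ.≃-trans (ℚ.toℚᵘ-homo-+ (fromℚᵘ p) (fromℚᵘ q))
      (ℚᵘ.+-cong (ℚ.toℚᵘ-fromℚᵘ p) (ℚ.toℚᵘ-fromℚᵘ q)))))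

  fromℚᵘ-homo-* : ∀ p q → fromℚᵘ (p ℚᵘ.* q) ≡ fromℚᵘ p ℚ.* fromℚᵘ q
  fromℚᵘ-homo-* p q = ℚ.toℚᵘ-injective (ℚᵘ.≃-trans (ℚ.toℚᵘ-fromℚᵘ (p ℚᵘ.* q)) (ℚᵘ.≃-sym
    (ℚᵘ.≃-trans (ℚ.toℚᵘ-homo-* (fromℚᵘ p) (fromℚᵘ q))
      (ℚᵘ.*-cong (ℚ.toℚᵘ-fromℚᵘ p) (ℚ.toℚᵘ-fromℚᵘ q)))))

  fromℚᵘ-mono-≤ : ∀ {p q} → p ℚᵘ.≤ q → fromℚᵘ p ℚ.≤ fromℚᵘ q
  fromℚᵘ-mono-≤ {p} {q} p≤q = ℚ.toℚᵘ-cancel-≤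
    (ℚᵘ.≤-respʳ-≃ (ℚᵘ.≃-sym (ℚ.toℚᵘ-fromℚᵘ q)) (ℚᵘ.≤-respˡ-≃ (ℚᵘ.≃-sym (ℚ.toℚᵘ-fromℚᵘ p)) p≤q))

  ι-+ : ∀ m n → ι (m ℕ.+ n) ≡ ι m ℚ.+ ι n
  ι-+ m n = trans (ℚ.fromℚᵘ-cong {ℚᵘ.mkℚᵘ (+ (m ℕ.+ n)) 0} {ℚᵘ.mkℚᵘ (+ m) 0 ℚᵘ.+ ℚᵘ.mkℚᵘ (+ n) 0}
      (ℚᵘ.*≡* (cong (_* + 1) (sym (cong₂ ℤ._+_ (ℤ.*-identityʳ (+ m)) (ℤ.*-identityʳ (+ n)))))))
    (fromℚᵘ-homo-+ (ℚᵘ.mkℚᵘ (+ m) 0) (ℚᵘ.mkℚᵘ (+ n) 0))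

  ι-* : ∀ m n → ι (m ℕ.* n) ≡ ι m ℚ.* ι n
  ι-* m n = trans (ℚ.fromℚᵘ-cong {ℚᵘ.mkℚᵘ (+ (m ℕ.* n)) 0} {ℚᵘ.mkℚᵘ (+ m) 0 ℚᵘ.* ℚᵘ.mkℚᵘ (+ n) 0}
      (ℚᵘ.*≡* (cong (_* + 1) (ℤ.pos-* m n))))
    (fromℚᵘ-homo-* (ℚᵘ.mkℚᵘ (+ m) 0) (ℚᵘ.mkℚᵘ (+ n) 0))

  ι-mono-≤ : ∀ {m n} → m ≤ n → ι m ℚ.≤ ι n
  ι-mono-≤ {m} {n} m≤n = fromℚᵘ-mono-≤ {ℚᵘ.mkℚᵘ (+ m) 0} {ℚᵘ.mkℚᵘ (+ n) 0}
    (ℚᵘ.*≤* (ℤ.*-monoʳ-≤-nonNeg (+ 1) (ℤ.+≤+ m≤n)))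

  /-*-cancel : ∀ i n .{{_ : ℕ.NonZero n}} → (i / n) ℚ.* ι n ≡ i / 1
  /-*-cancel i n@(ℕ.suc m) = trans (sym (fromℚᵘ-homo-* (ℚᵘ.mkℚᵘ i m) (ℚᵘ.mkℚᵘ (+ n) 0)))
    (ℚ.fromℚᵘ-cong {ℚᵘ.mkℚᵘ i m ℚᵘ.* ℚᵘ.mkℚᵘ (+ n) 0} {ℚᵘ.mkℚᵘ i 0}
      (ℚᵘ.*≡* (trans (ℤ.*-identityʳ (i * + n)) (cong (λ k → i * + k) (sym (ℕ.*-identityʳ n))))))

-- Sums over finite sets

indicator : Bool → ℚ → ℚ
indicator b q = if b then q else 0ℚ

abstract
  sumℚ-mono : ∀ {A : Set} (xs : List A) {f g : A → ℚ} → (∀ x → f x ℚ.≤ g x) → sumℚ xs f ℚ.≤ sumℚ xs g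
  sumℚ-mono []       f≤g = ℚ.≤-refl
  sumℚ-mono (x ∷ xs) f≤g = ℚ.+-mono-≤ (f≤g x) (sumℚ-mono xs f≤g)

  sumℚ-+ : ∀ {A : Set} (xs : List A) (f g : A → ℚ) →
    sumℚ xs (λ x → f x ℚ.+ g x) ≡ sumℚ xs f ℚ.+ sumℚ xs g
  sumℚ-+ []       f g = refl
  sumℚ-+ (x ∷ xs) f g = trans (cong (f x ℚ.+ g x ℚ.+_) (sumℚ-+ xs f g))
    (interchange (f x) (g x) (sumℚ xs f) (sumℚ xs g))
    where
    open +-*-Solver
    interchange : ∀ a b c d → a ℚ.+ b ℚ.+ (c ℚ.+ d) ≡ (a ℚ.+ c) ℚ.+ (b ℚ.+ d)
    interchange = solve 4 (λ a b c d → a :+ b :+ (c :+ d) := (a :+ c) :+ (b :+ d)) refl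

  sumℚ-0 : ∀ {A : Set} (xs : List A) → sumℚ xs (λ _ → 0ℚ) ≡ 0ℚ
  sumℚ-0 []       = refl
  sumℚ-0 (x ∷ xs) = trans (ℚ.+-identityˡ (sumℚ xs (λ _ → 0ℚ))) (sumℚ-0 xs)

  sumℚ-++ : ∀ {A : Set} (xs ys : List A) (f : A → ℚ) → sumℚ (xs ++ ys) f ≡ sumℚ xs f ℚ.+ sumℚ ys f
  sumℚ-++ []       ys f = sym (ℚ.+-identityˡ (sumℚ ys f))
  sumℚ-++ (x ∷ xs) ys f = trans (cong (f x ℚ.+_) (sumℚ-++ xs ys f))
    (sym (ℚ.+-assoc (f x) (sumℚ xs f) (sumℚ ys f)))

  sumℚ-map : ∀ {A B : Set} (h : A → B) xs (f : B → ℚ) → sumℚ (map h xs) f ≡ sumℚ xs (f ∘ h)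
  sumℚ-map h []       f = refl
  sumℚ-map h (x ∷ xs) f = cong (f (h x) ℚ.+_) (sumℚ-map h xs f)

  sumℚ-cartesianProduct : ∀ {A B : Set} (xs : List A) (ys : List B) (f : A × B → ℚ) →
    sumℚ (cartesianProduct xs ys) f ≡ sumℚ xs (λ x → sumℚ ys (λ y → f (x , y)))
  sumℚ-cartesianProduct []       ys f = refl
  sumℚ-cartesianProduct (x ∷ xs) ys f = trans
    (sumℚ-++ (map (x ,_) ys) (cartesianProduct xs ys) f)
    (cong₂ ℚ._+_ (sumℚ-map (x ,_) ys f) (sumℚ-cartesianProduct xs ys f))

  sumℚ-filter : ∀ {A : Set} {P : Pred A 0ℓ} (P? : Decidable P) xs (f : A → ℚ) →
    sumℚ (filter P? xs) f ≡ sumℚ xs (λ x → indicator (does (P? x)) (f x))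
  sumℚ-filter P? []       f = refl
  sumℚ-filter P? (x ∷ xs) f with does (P? x)
  ... | true  = cong (f x ℚ.+_) (sumℚ-filter P? xs f)
  ... | false = trans (sumℚ-filter P? xs f) (sym (ℚ.+-identityˡ _))

  sumℚ-tabulate : ∀ {A : Set} {n} (h : Fin n → A) (f : A → ℚ) →
    sumℚ (tabulate h) f ≡ sumℚ (allFin n) (f ∘ h)
  sumℚ-tabulate {n = ℕ.zero}  h f = refl
  sumℚ-tabulate {n = ℕ.suc n} h f = cong (f (h zero) ℚ.+_)
    (trans (sumℚ-tabulate (h ∘ suc) f) (sym (sumℚ-tabulate suc (f ∘ h))))

  sumℚ-allFin-suc : ∀ {n} (f : Fin (ℕ.suc n) → ℚ) →
    sumℚ (allFin (ℕ.suc n)) f ≡ f zero ℚ.+ sumℚ (allFin n) (f ∘ suc)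
  sumℚ-allFin-suc f = cong (f zero ℚ.+_) (sumℚ-tabulate suc f)

  sumℚ-δ : ∀ {n} (t : Fin n) (f : Fin n → ℚ) →
    sumℚ (allFin n) (λ x → indicator (does (x ≟ t)) (f x)) ≡ f t
  sumℚ-δ {ℕ.suc n} zero f = trans (sumℚ-allFin-suc (λ x → indicator (does (x ≟ zero)) (f x)))
    (trans (cong (f zero ℚ.+_) (sumℚ-0 (allFin n))) (ℚ.+-identityʳ (f zero)))
  sumℚ-δ {ℕ.suc n} (suc t) f = trans (sumℚ-allFin-suc (λ x → indicator (does (x ≟ suc t)) (f x)))
    (trans (ℚ.+-identityˡ _) (sumℚ-δ t (f ∘ suc)))

  sumℚ-subset : ∀ {n} (S : Subset n) k →
    sumℚ (allFin n) (λ x → indicator (does (x ∈? S)) k) ≡ ι ∣ S ∣ ℚ.* k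
  sumℚ-subset []            k = sym (ℚ.*-zeroˡ k)
  sumℚ-subset (inside ∷ S)  k = begin
    sumℚ (allFin _) (λ x → indicator (does (x ∈? (inside ∷ S))) k)
      ≡⟨ sumℚ-allFin-suc (λ x → indicator (does (x ∈? (inside ∷ S))) k) ⟩
    k ℚ.+ sumℚ (allFin _) (λ x → indicator (does (x ∈? S)) k)
      ≡⟨ cong₂ ℚ._+_ (sym (ℚ.*-identityˡ k)) (sumℚ-subset S k) ⟩
    1ℚ ℚ.* k ℚ.+ ι ∣ S ∣ ℚ.* k
      ≡⟨ ℚ.*-distribʳ-+ k 1ℚ (ι ∣ S ∣) ⟨
    (1ℚ ℚ.+ ι ∣ S ∣) ℚ.* k
      ≡⟨ cong (ℚ._* k) (ι-+ 1 ∣ S ∣) ⟨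
    ι (ℕ.suc ∣ S ∣) ℚ.* k ∎
    where open ≡-Reasoning
  sumℚ-subset (outside ∷ S) k = trans (sumℚ-allFin-suc (λ x → indicator (does (x ∈? (outside ∷ S))) k))
    (trans (ℚ.+-identityˡ _) (sumℚ-subset S k))

  -- The boundary size, the boundary mean and the squared norm of the test function are all
  -- instances, with `φ` equal to 1, `side` and the square of `side`.
  sumℚ-split : ∀ {n} (T S : Subset n) (φ : Bool → ℚ) →
    sumℚ (filter (_∈? S) (allFin n)) (λ x → φ (does (x ∈? T))) ≡
    ι ∣ T ∩ S ∣ ℚ.* φ true ℚ.+ ι ∣ S Subset.─ T ∣ ℚ.* φ false
  sumℚ-split {n} T S φ = begin
    sumℚ (filter (_∈? S) (allFin n)) (λ x → φ (does (x ∈? T)))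
      ≡⟨ sumℚ-filter (_∈? S) (allFin n) (λ x → φ (does (x ∈? T))) ⟩
    sumℚ (allFin n) (λ x → indicator (does (x ∈? S)) (φ (does (x ∈? T))))
      ≡⟨ sumℚ-cong (allFin n) (pointwise T S) ⟩
    sumℚ (allFin n) (λ x → indicator (does (x ∈? (T ∩ S))) (φ true) ℚ.+
                           indicator (does (x ∈? (S Subset.─ T))) (φ false))
      ≡⟨ sumℚ-+ (allFin n) (λ x → indicator (does (x ∈? (T ∩ S))) (φ true))
                           (λ x → indicator (does (x ∈? (S Subset.─ T))) (φ false)) ⟩
    sumℚ (allFin n) (λ x → indicator (does (x ∈? (T ∩ S))) (φ true)) ℚ.+
    sumℚ (allFin n) (λ x → indicator (does (x ∈? (S Subset.─ T))) (φ false))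
      ≡⟨ cong₂ ℚ._+_ (sumℚ-subset (T ∩ S) (φ true)) (sumℚ-subset (S Subset.─ T) (φ false)) ⟩
    ι ∣ T ∩ S ∣ ℚ.* φ true ℚ.+ ι ∣ S Subset.─ T ∣ ℚ.* φ false ∎
    where
    open ≡-Reasoning
    pointwise : ∀ {n} (T S : Subset n) (x : Fin n) →
      indicator (does (x ∈? S)) (φ (does (x ∈? T))) ≡
      indicator (does (x ∈? (T ∩ S))) (φ true) ℚ.+ indicator (does (x ∈? (S Subset.─ T))) (φ false)
    pointwise (inside  ∷ T) (inside  ∷ S) zero = sym (ℚ.+-identityʳ (φ true))
    pointwise (inside  ∷ T) (outside ∷ S) zero = refl
    pointwise (outside ∷ T) (inside  ∷ S) zero = sym (ℚ.+-identityˡ (φ false))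
    pointwise (outside ∷ T) (outside ∷ S) zero = refl
    pointwise (_ ∷ T) (_ ∷ S) (suc x) = pointwise T S x

  -- The matrix `c` lives on row `t` and column `t`; the diagonal entry is counted twice on the
  -- right, hence an inequality.
  sumℚ-star : ∀ {n} (t : Fin n) (c : Fin n → Fin n → ℚ) → (∀ x y → 0ℚ ℚ.≤ c x y) →
    (∀ {x y} → x ≢ t → y ≢ t → c x y ≡ 0ℚ) →
    sumℚ (allFin n) (λ x → sumℚ (allFin n) (c x)) ℚ.≤ sumℚ (allFin n) (λ y → c t y ℚ.+ c y t)
  sumℚ-star {n} t c 0≤c c≡0 = begin
    sumℚ (allFin n) (λ x → sumℚ (allFin n) (c x))
      ≤⟨ sumℚ-mono (allFin n) row ⟩
    sumℚ (allFin n) (λ x → indicator (does (x ≟ t)) (sumℚ (allFin n) (c t)) ℚ.+ c x t)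
      ≡⟨ sumℚ-+ (allFin n) (λ x → indicator (does (x ≟ t)) (sumℚ (allFin n) (c t))) (λ x → c x t) ⟩
    sumℚ (allFin n) (λ x → indicator (does (x ≟ t)) (sumℚ (allFin n) (c t))) ℚ.+
    sumℚ (allFin n) (λ x → c x t)
      ≡⟨ cong (ℚ._+ sumℚ (allFin n) (λ x → c x t)) (sumℚ-δ t (λ _ → sumℚ (allFin n) (c t))) ⟩
    sumℚ (allFin n) (c t) ℚ.+ sumℚ (allFin n) (λ x → c x t)
      ≡⟨ sumℚ-+ (allFin n) (c t) (λ x → c x t) ⟨
    sumℚ (allFin n) (λ y → c t y ℚ.+ c y t) ∎
    where
    open ℚ.≤-Reasoning
    entry : ∀ {x} → x ≢ t → ∀ y → c x y ℚ.≤ indicator (does (y ≟ t)) (c x y)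
    entry x≢t y with y ≟ t
    ... | yes refl = ℚ.≤-refl
    ... | no  y≢t  = ℚ.≤-reflexive (c≡0 x≢t y≢t)
    row : ∀ x → sumℚ (allFin n) (c x) ℚ.≤ indicator (does (x ≟ t)) (sumℚ (allFin n) (c t)) ℚ.+ c x t
    row x with x ≟ t
    ... | yes refl = subst (ℚ._≤ sumℚ (allFin n) (c t) ℚ.+ c t t) (ℚ.+-identityʳ (sumℚ (allFin n) (c t)))
      (ℚ.+-monoʳ-≤ (sumℚ (allFin n) (c t)) (0≤c t t))
    ... | no  x≢t  = begin
      sumℚ (allFin n) (c x)                                       ≤⟨ sumℚ-mono (allFin n) (entry x≢t) ⟩
      sumℚ (allFin n) (λ y → indicator (does (y ≟ t)) (c x y))    ≡⟨ sumℚ-δ t (c x) ⟩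
      c x t                                                       ≡⟨ ℚ.+-identityˡ (c x t) ⟨
      0ℚ ℚ.+ c x t                                                ∎

-- Arithmetic of a balanced split

abstract
  square-of-sum-≤-ordered : ∀ d w b → w ≤ b → b ≤ d ℕ.* w →
    (w ℕ.+ b) ℕ.* (w ℕ.+ b) ≤ 4 ℕ.* d ℕ.* (w ℕ.* b)
  square-of-sum-≤-ordered d w b w≤b b≤dw = begin
    (w ℕ.+ b) ℕ.* (w ℕ.+ b)    ≤⟨ ℕ.*-mono-≤ (ℕ.+-monoˡ-≤ b w≤b) (ℕ.+-monoˡ-≤ b w≤b) ⟩
    (b ℕ.+ b) ℕ.* (b ℕ.+ b)    ≡⟨ double b ⟩
    4 ℕ.* b ℕ.* b              ≤⟨ ℕ.*-monoˡ-≤ b (ℕ.*-monoʳ-≤ 4 b≤dw) ⟩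
    4 ℕ.* (d ℕ.* w) ℕ.* b      ≡⟨ regroup d w b ⟩
    4 ℕ.* d ℕ.* (w ℕ.* b)      ∎
    where
    open ℕ.≤-Reasoning
    double : ∀ b → (b ℕ.+ b) ℕ.* (b ℕ.+ b) ≡ 4 ℕ.* b ℕ.* b
    double = ℕ-Solver.solve-∀
    regroup : ∀ d w b → 4 ℕ.* (d ℕ.* w) ℕ.* b ≡ 4 ℕ.* d ℕ.* (w ℕ.* b)
    regroup = ℕ-Solver.solve-∀

  -- Here `d` stands for D - 1. Which part is the larger decides which of the two hypotheses is
  -- used.
  square-of-sum-≤ : ∀ d w b → w ℕ.+ b ≤ ℕ.suc d ℕ.* w → w ℕ.+ b ≤ ℕ.suc d ℕ.* b →
    (w ℕ.+ b) ℕ.* (w ℕ.+ b) ≤ 4 ℕ.* d ℕ.* (w ℕ.* b)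
  square-of-sum-≤ d w b ≤w ≤b with ℕ.≤-total w b
  ... | inj₁ w≤b = square-of-sum-≤-ordered d w b w≤b (ℕ.+-cancelˡ-≤ w b (d ℕ.* w) ≤w)
  ... | inj₂ b≤w = subst₂ _≤_
    (cong₂ ℕ._*_ (ℕ.+-comm b w) (ℕ.+-comm b w)) (cong (4 ℕ.* d ℕ.*_) (ℕ.*-comm b w))
    (square-of-sum-≤-ordered d b w b≤w
      (ℕ.+-cancelˡ-≤ b w (d ℕ.* b) (subst (_≤ ℕ.suc d ℕ.* b) (ℕ.+-comm w b) ≤b)))

-- The test function of a cut

module _ {n : ℕ} (G : Graph n) (δΩ : Subset n) (T : Subset n) (t : Fin n) (t∈T : t ∈ T)
         (T-exit : ∀ {x y} → Graph._~_ G x y → x ∈ T → y ∉ T → x ≡ t) where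
  open Graph G

  w b : ℕ
  w = ∣ T ∩ δΩ ∣
  b = ∣ δΩ Subset.─ T ∣

  side : Bool → ℚ
  side true  = ι b
  side false = ℚ.- ι w

  testFunction : Fin n → ℚ
  testFunction x = side (does (x ∈? T))

  cut : Subset n
  cut = neighbours t Subset.─ T

  private
    L² : ℚ
    L² = (ι w ℚ.+ ι b) ℚ.* (ι w ℚ.+ ι b)

    jump : Fin n → Fin n → ℚ
    jump x y = (testFunction x ℚ.- testFunction y) ℚ.* (testFunction x ℚ.- testFunction y)

    edge? : ∀ x y → Dec (x Fin.< y × x ~ y)
    edge? x y = (x <? y) ×-dec (x ~? y)

    edgeEnergy : Fin n → Fin n → ℚ
    edgeEnergy x y = indicator (does (edge? x y)) (jump x y)

    indicator≥0 : ∀ c {p} → 0ℚ ℚ.≤ p → 0ℚ ℚ.≤ indicator c p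
    indicator≥0 true  0≤p = 0≤p
    indicator≥0 false _   = ℚ.≤-refl

    indicator≤ : ∀ c {p} → 0ℚ ℚ.≤ p → indicator c p ℚ.≤ p
    indicator≤ true  _   = ℚ.≤-refl
    indicator≤ false 0≤p = 0≤p

    indicator≡0 : ∀ {A : Set} (A? : Dec A) {p} → (A → p ≡ 0ℚ) → indicator (does A?) p ≡ 0ℚ
    indicator≡0 (yes a) p≡0 = p≡0 a
    indicator≡0 (no _)  _   = refl

    abstract
      edgeEnergy≡0 : ∀ {x y} → ¬ (x Fin.< y × x ~ y) → edgeEnergy x y ≡ 0ℚ
      edgeEnergy≡0 {x} {y} ¬edge = indicator≡0 (edge? x y) λ edge → contradiction edge ¬edge

      edgeEnergy≤jump : ∀ x y → edgeEnergy x y ℚ.≤ jump x y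
      edgeEnergy≤jump x y = indicator≤ (does (edge? x y)) (square≥0 (testFunction x ℚ.- testFunction y))

      edgeEnergy≥0 : ∀ x y → 0ℚ ℚ.≤ edgeEnergy x y
      edgeEnergy≥0 x y = indicator≥0 (does (edge? x y)) (square≥0 (testFunction x ℚ.- testFunction y))

      side-difference : ∀ p → (p ℚ.- p) ℚ.* (p ℚ.- p) ≡ 0ℚ
      side-difference = solve 1 (λ p → (p :- p) :* (p :- p) := con 0ℚ) refl
        where open +-*-Solver

      side-jump : ∀ p q → (q ℚ.- (ℚ.- p)) ℚ.* (q ℚ.- (ℚ.- p)) ≡ (p ℚ.+ q) ℚ.* (p ℚ.+ q)
      side-jump = solve 2 (λ p q → (q :- (:- p)) :* (q :- (:- p)) := (p :+ q) :* (p :+ q)) refl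
        where open +-*-Solver

      jump-sym : ∀ x y → jump x y ≡ jump y x
      jump-sym x y = solve 2 (λ p q → (p :- q) :* (p :- q) := (q :- p) :* (q :- p)) refl
        (testFunction x) (testFunction y)
        where open +-*-Solver

      edgeEnergy-away : ∀ {x y} → x ≢ t → y ≢ t → edgeEnergy x y ≡ 0ℚ
      edgeEnergy-away {x} {y} x≢t y≢t = indicator≡0 (edge? x y) (jump≡0 ∘ proj₂)
        where
        jump≡0 : x ~ y → jump x y ≡ 0ℚ
        jump≡0 x~y with x ∈? T | y ∈? T
        ... | yes _   | yes _   = side-difference (ι b)
        ... | no  _   | no  _   = side-difference (ℚ.- ι w)
        ... | yes x∈T | no  y∉T = contradiction (T-exit x~y x∈T y∉T) x≢t
        ... | no  x∉T | yes y∈T = contradiction (T-exit (~-sym x~y) y∈T x∉T) y≢t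

      jump≤cut : ∀ {y} → t ~ y → jump t y ℚ.≤ indicator (does (y ∈? cut)) L²
      jump≤cut {y} t~y with t ∈? T | y ∈? T | y ∈? cut
      ... | no t∉T | _       | _       = contradiction t∈T t∉T
      ... | yes _  | yes _   | cut?    = subst (ℚ._≤ indicator (does cut?) L²) (sym (side-difference (ι b)))
                                           (indicator≥0 (does cut?) (square≥0 (ι w ℚ.+ ι b)))
      ... | yes _  | no  _   | yes _   = ℚ.≤-reflexive (side-jump (ι w) (ι b))
      ... | yes _  | no  y∉T | no y∉c  =
        contradiction (x∈p∧x∉q⇒x∈p─q (∈-neighbours⁺ G t~y) y∉T) y∉c

      -- The list `edges` keeps only increasing pairs, so an edge between `t` and `y` contributes to
      -- exactly one of the two summands.
      edgeEnergy-at : ∀ y → edgeEnergy t y ℚ.+ edgeEnergy y t ℚ.≤ indicator (does (y ∈? cut)) L²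
      edgeEnergy-at y = cases (t ~? y) (t <? y)
        where
        open ℚ.≤-Reasoning
        cases : Dec (t ~ y) → Dec (t Fin.< y) →
          edgeEnergy t y ℚ.+ edgeEnergy y t ℚ.≤ indicator (does (y ∈? cut)) L²
        cases (no ¬t~y) _ = subst (ℚ._≤ indicator (does (y ∈? cut)) L²)
          (sym (cong₂ ℚ._+_ (edgeEnergy≡0 (¬t~y ∘ proj₂)) (edgeEnergy≡0 (¬t~y ∘ ~-sym ∘ proj₂))))
          (indicator≥0 (does (y ∈? cut)) (square≥0 (ι w ℚ.+ ι b)))
        cases (yes t~y) (yes t<y) = begin
          edgeEnergy t y ℚ.+ edgeEnergy y t
            ≡⟨ cong (edgeEnergy t y ℚ.+_) (edgeEnergy≡0 (<-asym t<y ∘ proj₁)) ⟩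
          edgeEnergy t y ℚ.+ 0ℚ                ≡⟨ ℚ.+-identityʳ (edgeEnergy t y) ⟩
          edgeEnergy t y                       ≤⟨ edgeEnergy≤jump t y ⟩
          jump t y                             ≤⟨ jump≤cut t~y ⟩
          indicator (does (y ∈? cut)) L²       ∎
        cases (yes t~y) (no t≮y) = begin
          edgeEnergy t y ℚ.+ edgeEnergy y t
            ≡⟨ cong (ℚ._+ edgeEnergy y t) (edgeEnergy≡0 (t≮y ∘ proj₁)) ⟩
          0ℚ ℚ.+ edgeEnergy y t                ≡⟨ ℚ.+-identityˡ (edgeEnergy y t) ⟩
          edgeEnergy y t                       ≤⟨ edgeEnergy≤jump y t ⟩
          jump y t                             ≡⟨ jump-sym y t ⟩
          jump t y                             ≤⟨ jump≤cut t~y ⟩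
          indicator (does (y ∈? cut)) L²       ∎

  abstract
    testFunction-energy : rationalEnergy G δΩ testFunction ℚ.≤
      ι ∣ cut ∣ ℚ.* ((ι w ℚ.+ ι b) ℚ.* (ι w ℚ.+ ι b))
    testFunction-energy = begin
      sumℚ edges (λ (x , y) → jump x y)
        ≡⟨ sumℚ-filter (λ (x , y) → edge? x y) (cartesianProduct (allFin n) (allFin n)) (λ (x , y) → jump x y) ⟩
      sumℚ (cartesianProduct (allFin n) (allFin n)) (λ (x , y) → edgeEnergy x y)
        ≡⟨ sumℚ-cartesianProduct (allFin n) (allFin n) (λ (x , y) → edgeEnergy x y) ⟩
      sumℚ (allFin n) (λ x → sumℚ (allFin n) (edgeEnergy x))
        ≤⟨ sumℚ-star t edgeEnergy edgeEnergy≥0 edgeEnergy-away ⟩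
      sumℚ (allFin n) (λ y → edgeEnergy t y ℚ.+ edgeEnergy y t)
        ≤⟨ sumℚ-mono (allFin n) edgeEnergy-at ⟩
      sumℚ (allFin n) (λ y → indicator (does (y ∈? cut)) L²)
        ≡⟨ sumℚ-subset cut L² ⟩
      ι ∣ cut ∣ ℚ.* L² ∎
      where open ℚ.≤-Reasoning

    testFunction-mean : sumℚ (boundary G δΩ) testFunction ≡ 0ℚ
    testFunction-mean = trans (sumℚ-split T δΩ side) (cancel (ι w) (ι b))
      where
      open +-*-Solver
      cancel : ∀ p q → p ℚ.* q ℚ.+ q ℚ.* (ℚ.- p) ≡ 0ℚ
      cancel = solve 2 (λ p q → p :* q :+ q :* (:- p) := con 0ℚ) refl

    testFunction-norm : rationalNorm² G δΩ testFunction ≡ ι (w ℕ.* b ℕ.* (w ℕ.+ b))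
    testFunction-norm = trans (sumℚ-split T δΩ (λ c → side c ℚ.* side c))
      (trans (expand (ι w) (ι b)) (sym (trans (ι-* (w ℕ.* b) (w ℕ.+ b)) (cong₂ ℚ._*_ (ι-* w b) (ι-+ w b)))))
      where
      open +-*-Solver
      expand : ∀ p q → p ℚ.* (q ℚ.* q) ℚ.+ q ℚ.* ((ℚ.- p) ℚ.* (ℚ.- p)) ≡ p ℚ.* q ℚ.* (p ℚ.+ q)
      expand = solve 2 (λ p q → p :* (q :* q) :+ q :* ((:- p) :* (:- p)) := p :* q :* (p :+ q)) refl

    boundary-size : boundarySize G δΩ ≡ ι (w ℕ.+ b)
    boundary-size = trans (sumℚ-split T δΩ (λ _ → 1ℚ))
      (trans (cong₂ ℚ._+_ (ℚ.*-identityʳ (ι w)) (ℚ.*-identityʳ (ι b))) (sym (ι-+ w b)))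

  -- The parameters `m` and `d` are to become B - 1 and D - 1. The bound on `q` is kept in
  -- multiplied form, with |δΩ| on the left, so that it comes down to an inequality of naturals.
  λ₂≤cutQuotient : ∀ {λ₂ d m} → 0 ℕ.< ∣ δΩ ∣ → ∣ cut ∣ ≤ m →
    ∣ δΩ ∣ ≤ ℕ.suc d ℕ.* w → ∣ δΩ ∣ ≤ ℕ.suc d ℕ.* b → IsSteklovEigenvalue G δΩ 2 λ₂ →
    ∃[ q ] λ₂ ≤∞ [ fromℚ q ] × q ℚ.* ι ∣ δΩ ∣ ℚ.≤ ι (4 ℕ.* m ℕ.* d)
  λ₂≤cutQuotient {λ₂} {d} {m} 0<∣δΩ∣ cut≤m δΩ≤w δΩ≤b eigenvalue =
    q , λ₂≤quotient G δΩ testFunction 1≤L 1≤N testFunction-mean q qN≡E eigenvalue , q*L≤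
    where
    L N-ℕ : ℕ
    L = w ℕ.+ b
    N-ℕ = w ℕ.* b ℕ.* L
    N E : ℚ
    N = rationalNorm² G δΩ testFunction
    E = rationalEnergy G δΩ testFunction
    δΩ≡L : ∣ δΩ ∣ ≡ L
    δΩ≡L = sym (∣p∩q∣+∣q─p∣≡∣q∣ T δΩ)
    -- Balance forces boundary vertices on both sides of the cut. The squared norm `w * b * L` is
    -- then a positive integer, which gives the lower bound 1 that the plane argument asks for.
    positive-factor : ∀ k → ∣ δΩ ∣ ≤ ℕ.suc d ℕ.* k → 1 ≤ k
    positive-factor ℕ.zero    δΩ≤0 = contradiction
      (ℕ.≤-trans 0<∣δΩ∣ (subst (∣ δΩ ∣ ≤_) (ℕ.*-zeroʳ (ℕ.suc d)) δΩ≤0)) ℕ.n≮0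
    positive-factor (ℕ.suc k) _    = ℕ.s≤s ℕ.z≤n
    1≤L-ℕ : 1 ≤ L
    1≤L-ℕ = subst (1 ≤_) δΩ≡L 0<∣δΩ∣
    1≤N-ℕ : 1 ≤ N-ℕ
    1≤N-ℕ = ℕ.*-mono-≤ (ℕ.*-mono-≤ (positive-factor w δΩ≤w) (positive-factor b δΩ≤b)) 1≤L-ℕ
    1≤L : 1ℚ ℚ.≤ boundarySize G δΩ
    1≤L = subst (1ℚ ℚ.≤_) (sym boundary-size) (ι-mono-≤ 1≤L-ℕ)
    1≤N : 1ℚ ℚ.≤ N
    1≤N = subst (1ℚ ℚ.≤_) (sym testFunction-norm) (ι-mono-≤ 1≤N-ℕ)
    0<N : 0ℚ ℚ.< N
    0<N = ℚ.<-≤-trans (ℚ.positive⁻¹ 1ℚ) 1≤N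
    q : ℚ
    q = E ℚ.* proj₁ (reciprocal 0<N)
    qN≡E : q ℚ.* N ≡ E
    qN≡E = trans (ℚ.*-assoc E (proj₁ (reciprocal 0<N)) N)
      (trans (cong (E ℚ.*_) (proj₂ (proj₂ (reciprocal 0<N)))) (ℚ.*-identityʳ E))
    L²≤ : L ℕ.* L ≤ 4 ℕ.* d ℕ.* (w ℕ.* b)
    L²≤ = square-of-sum-≤ d w b (subst (_≤ ℕ.suc d ℕ.* w) δΩ≡L δΩ≤w) (subst (_≤ ℕ.suc d ℕ.* b) δΩ≡L δΩ≤b)
    counting : ∣ cut ∣ ℕ.* (L ℕ.* L) ℕ.* L ≤ 4 ℕ.* m ℕ.* d ℕ.* N-ℕ
    counting = begin
      ∣ cut ∣ ℕ.* (L ℕ.* L) ℕ.* L                 ≤⟨ ℕ.*-monoˡ-≤ L (ℕ.*-mono-≤ cut≤m L²≤) ⟩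
      m ℕ.* (4 ℕ.* d ℕ.* (w ℕ.* b)) ℕ.* L         ≡⟨ regroup m d w b L ⟩
      4 ℕ.* m ℕ.* d ℕ.* (w ℕ.* b ℕ.* L)           ∎
      where
      open ℕ.≤-Reasoning
      regroup : ∀ m d w b l → m ℕ.* (4 ℕ.* d ℕ.* (w ℕ.* b)) ℕ.* l ≡ 4 ℕ.* m ℕ.* d ℕ.* (w ℕ.* b ℕ.* l)
      regroup = ℕ-Solver.solve-∀
    q*L≤ : q ℚ.* ι ∣ δΩ ∣ ℚ.≤ ι (4 ℕ.* m ℕ.* d)
    q*L≤ = ℚ.*-cancelʳ-≤-pos N {{ℚ.positive 0<N}} (begin
      q ℚ.* ι ∣ δΩ ∣ ℚ.* N                          ≡⟨ cong (λ l → q ℚ.* ι l ℚ.* N) δΩ≡L ⟩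
      q ℚ.* ι L ℚ.* N                               ≡⟨ swap q (ι L) N ⟩
      q ℚ.* N ℚ.* ι L                               ≡⟨ cong (ℚ._* ι L) qN≡E ⟩
      E ℚ.* ι L                                     ≤⟨ *-mono-≤ʳ (ι-mono-≤ {0} {L} ℕ.z≤n) testFunction-energy ⟩
      ι ∣ cut ∣ ℚ.* ((ι w ℚ.+ ι b) ℚ.* (ι w ℚ.+ ι b)) ℚ.* ι L
        ≡⟨ cong (λ l → ι ∣ cut ∣ ℚ.* (l ℚ.* l) ℚ.* ι L) (ι-+ w b) ⟨
      ι ∣ cut ∣ ℚ.* (ι L ℚ.* ι L) ℚ.* ι L
        ≡⟨ cong (λ p → ι ∣ cut ∣ ℚ.* p ℚ.* ι L) (ι-* L L) ⟨
      ι ∣ cut ∣ ℚ.* ι (L ℕ.* L) ℚ.* ι L             ≡⟨ cong (ℚ._* ι L) (ι-* ∣ cut ∣ (L ℕ.* L)) ⟨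
      ι (∣ cut ∣ ℕ.* (L ℕ.* L)) ℚ.* ι L             ≡⟨ ι-* (∣ cut ∣ ℕ.* (L ℕ.* L)) L ⟨
      ι (∣ cut ∣ ℕ.* (L ℕ.* L) ℕ.* L)               ≤⟨ ι-mono-≤ counting ⟩
      ι (4 ℕ.* m ℕ.* d ℕ.* N-ℕ)                     ≡⟨ ι-* (4 ℕ.* m ℕ.* d) N-ℕ ⟩
      ι (4 ℕ.* m ℕ.* d) ℚ.* ι N-ℕ                   ≡⟨ cong (ι (4 ℕ.* m ℕ.* d) ℚ.*_) testFunction-norm ⟨
      ι (4 ℕ.* m ℕ.* d) ℚ.* N                       ∎)
      where
      open ℚ.≤-Reasoning
      open +-*-Solver
      swap : ∀ p q r → p ℚ.* q ℚ.* r ≡ p ℚ.* r ℚ.* q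
      swap = solve 3 (λ p q r → p :* q :* r := p :* r :* q) refl

-- Removing the double negation and concluding

≤∞ℚ-stable : ∀ x q → ¬ ¬ (x ≤∞ [ fromℚ q ]) → x ≤∞ [ fromℚ q ]
≤∞ℚ-stable [ x ] q ¬¬x≤q = [ ≤ℚ-stable x q (¬¬-map [≤]-injective ¬¬x≤q) ]
≤∞ℚ-stable ⊤⁺    q ¬¬x≤q = ⊥-elim (¬¬x≤q λ ())

≤∞ℚ-trans : ∀ {x p q} → x ≤∞ [ fromℚ p ] → p ℚ.≤ q → x ≤∞ [ fromℚ q ]
≤∞ℚ-trans [ x≤p ] p≤q = [ (λ ε 0<ε → let N , h = x≤p ε 0<ε in
  N , λ n n≥ → ℚ.≤-trans (h n n≥) (ℚ.+-monoˡ-≤ ε p≤q)) ]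

-- Excluded middle is irrefutable for each triple, and double negation commutes with quantification
-- over the finite type `Fin n`.
¬¬-joined? : ∀ {n} (G : Graph n) → ¬ ¬ (∀ v x y → Dec (JoinedAvoiding G v x y))
¬¬-joined? G = ∀¬¬ λ v → ∀¬¬ λ x → ∀¬¬ λ y → ¬¬-excluded-middle
  where
  ∀¬¬ : ∀ {n} {P : Pred (Fin n) 0ℓ} → (∀ i → ¬ ¬ P i) → ¬ ¬ (∀ i → P i)
  ∀¬¬ = sequence (RawMonad.rawApplicative ¬¬-Monad)

theorem1p2 : ∀ {n : ℕ} (G : Graph n) (δΩ : Subset n) (D B : ℕ) (λ₂ : ℝ ⁺) →
    IsBlockGraph G →
    IsMaxDegree G D →
    IsMaxBlockSize G B →
    2 ≤ D →
    (2≤∣δΩ∣ : 2 ≤ ∣ δΩ ∣) →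
    δΩ ⊆ Graph.leafSet G →
    IsSteklovEigenvalue G δΩ 2 λ₂ →
    λ₂ ≤∞ [ fromℚ (_/_ (+ 4 * (+ B - + 1) * (+ D - + 1)) ∣ δΩ ∣ {{>-nonZero (<⇒≤ 2≤∣δΩ∣)}}) ]
theorem1p2 G δΩ D B λ₂ blockGraph maxD maxB 2≤D 2≤∣δΩ∣ δΩ⊆leaves eigenvalue =
  ≤∞ℚ-stable λ₂ bound (¬¬-map fromDecidableJoins (¬¬-joined? G))
  where
  instance
    ∣δΩ∣≢0 : ℕ.NonZero ∣ δΩ ∣
    ∣δΩ∣≢0 = >-nonZero (<⇒≤ 2≤∣δΩ∣)

  bound : ℚ
  bound = (+ 4 * (+ B - + 1) * (+ D - + 1)) / ∣ δΩ ∣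

  -- The differences in the bound are taken in the integers and agree with `pred` only for positive
  -- arguments; for `B`, positivity is read off from the strict inequality `cut<B`.
  numerator : ∀ D B → 1 ≤ D → 1 ≤ B →
    + 4 * (+ B - + 1) * (+ D - + 1) ≡ + (4 ℕ.* ℕ.pred B ℕ.* ℕ.pred D)
  numerator (ℕ.suc D) (ℕ.suc B) _ _ =
    trans (cong (_* + D) (sym (ℤ.pos-* 4 B))) (sym (ℤ.pos-* (4 ℕ.* B) D))

  fromDecidableJoins : (∀ v x y → Dec (JoinedAvoiding G v x y)) → λ₂ ≤∞ [ fromℚ bound ]
  fromDecidableJoins joined? = ≤∞ℚ-trans (proj₁ (proj₂ quotient)) q≤bound
    where
    leaf : Nonempty δΩ
    leaf = 0<∣p∣⇒Nonempty δΩ (<⇒≤ 2≤∣δΩ∣)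
    r : Fin _
    r = proj₁ leaf
    balanced = exists-balanced G blockGraph joined? r maxD 2≤D δΩ 2≤∣δΩ∣ δΩ⊆leaves (proj₂ leaf)
    t : Fin _
    t = proj₁ balanced
    T : Subset _
    T = subtree G blockGraph joined? r t
    cut<B : ∣ Graph.neighbours G t Subset.─ T ∣ ℕ.< B
    cut<B = ∣exits∣<B G blockGraph joined? r maxB t
    suc-pred-D : ℕ.suc (ℕ.pred D) ≡ D
    suc-pred-D = ℕ.suc-pred D {{>-nonZero (<⇒≤ 2≤D)}}
    quotient = λ₂≤cutQuotient G δΩ T t (∈-subtree⁺ G blockGraph joined? r (inj₁ refl))
      (subtree-exit G blockGraph joined? r) {d = ℕ.pred D} {m = ℕ.pred B} (<⇒≤ 2≤∣δΩ∣)
      (ℕ.<⇒≤pred cut<B)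
      (subst (λ d → ∣ δΩ ∣ ≤ d ℕ.* ∣ T ∩ δΩ ∣) (sym suc-pred-D) (proj₁ (proj₂ balanced)))
      (subst (λ d → ∣ δΩ ∣ ≤ d ℕ.* ∣ δΩ Subset.─ T ∣) (sym suc-pred-D) (proj₂ (proj₂ balanced)))
      eigenvalue
    q : ℚ
    q = proj₁ quotient
    q≤bound : q ℚ.≤ bound
    q≤bound = ℚ.*-cancelʳ-≤-pos (ι ∣ δΩ ∣)
      {{ℚ.positive (ℚ.<-≤-trans (ℚ.positive⁻¹ 1ℚ) (ι-mono-≤ {1} (<⇒≤ 2≤∣δΩ∣)))}} (begin
        q ℚ.* ι ∣ δΩ ∣                                    ≤⟨ proj₂ (proj₂ quotient) ⟩
        ι (4 ℕ.* ℕ.pred B ℕ.* ℕ.pred D)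
          ≡⟨ cong (_/ 1) (numerator D B (<⇒≤ 2≤D) (ℕ.≤-trans (ℕ.s≤s ℕ.z≤n) cut<B)) ⟨
        (+ 4 * (+ B - + 1) * (+ D - + 1)) / 1
          ≡⟨ /-*-cancel (+ 4 * (+ B - + 1) * (+ D - + 1)) ∣ δΩ ∣ ⟨
        bound ℚ.* ι ∣ δΩ ∣                                ∎)
      where open ℚ.≤-Reasoning
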